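{- Let $G$ be a finite abelian group such that the Schrijver–Seymour statement holds for $G$ and for every subgroup of $G$. Then $G$ is $(|G|-1)$-close.
   Context: Matroids are finite and loopless. For a matroid $M=(E,\mathcal{I})$ with rank function $r$ and a finite abelian group $K$, a $K$-labeling is a map $\ell:E\to K$, with $\ell(F)=\sum_{e\in F}\ell(e)$; let $\ell(M)=\{\ell(B): B \text{ a base of } M\}$, and for $S\subseteq K$ let $E(S)=\{e\in E:\ell(e)\in S\}$. The stabilizer of $S\subseteq K$ is $\mathrm{stab}(S)=\{h\in K: h+S=S\}$, a subgroup. The Schrijver–Seymour statement holds for $K$ if for every matroid $M$ and every $K$-labeling $\ell$, with $H=\mathrm{stab}(\ell(M))$, one has $|\ell(M)|\ge |H|\cdot\min\big\{\sum_{Q\in K/H} r(E(Q))-r(M)+1,\ |K|/|H|\big\}$, where the sum is over the cosets $Q$ of $H$. A $g$-base is a base $B$ with $\ell(B)=g$. A $G$-labeling $\ell$ of $M$ is $k$-close if for every $g\in G$ for which a $g$-base exists, every base $A$ has a $g$-base $B$ with $|A\setminus B|\le k$; $G$ is $k$-close if every $G$-labeling of every matroid is $k$-close. -}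

module Defs where

open import Data.Nat using (ℕ; zero; suc; _+_; _*_; _∸_; _⊔_; _⊓_; _≤_; _<_; _/_)
open import Data.Bool using (Bool; true; false; if_then_else_)
open import Data.Fin using (Fin; zero; suc; toℕ)
open import Data.Fin.Properties using (_≟_; all?; any?)
open import Data.Fin.Subset using (Subset; _∈_; _∉_; ⁅_⁆; _∪_; _─_; ∣_∣; _⊆_; ⊤; ⊥)
open import Data.Fin.Subset.Properties using (_∈?_; _⊆?_; ∈⊤)
open import Data.List using (List; []; _∷_; map; filter; foldr; _++_; allFin)
open import Data.Nat.ListAction using (sum)
open import Data.List.Relation.Unary.Any using (Any)
import Data.List.Relation.Unary.Any as Any
open import Data.Vec using (Vec; []; _∷_; tabulate)
open import Data.Product using (Σ; ∃; ∃-syntax; _×_; _,_)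
open import Relation.Nullary using (¬_; Dec; does)
open import Relation.Nullary.Decidable using (_×-dec_; _→-dec_; ¬?)
open import Relation.Unary using (Pred; Decidable)
open import Relation.Binary.PropositionalEquality using (_≡_)
open import Algebra.Structures using (IsAbelianGroup)

-- Finite abelian groups: carrier Fin n (every finite abelian group is
-- isomorphic to one of these), operations with propositional equality.

record FinAbGroup : Set where
  field
    n : ℕ
    _⊕_ : Fin n → Fin n → Fin n
    𝟘 : Fin n
    ⊖_ : Fin n → Fin n
    isAbelianGroup : IsAbelianGroup _≡_ _⊕_ 𝟘 ⊖_

record Subgroup (G : FinAbGroup) : Set where
  open FinAbGroup G
  field
    carrier : Subset n
    𝟘∈ : 𝟘 ∈ carrier
    ⊕-closed : ∀ {x y} → x ∈ carrier → y ∈ carrier → (x ⊕ y) ∈ carrier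
    ⊖-closed : ∀ {x} → x ∈ carrier → (⊖ x) ∈ carrier

wholeGroup : (G : FinAbGroup) → Subgroup G
wholeGroup G = record
  { carrier = ⊤ ; 𝟘∈ = ∈⊤ ; ⊕-closed = λ _ _ → ∈⊤ ; ⊖-closed = λ _ → ∈⊤ }

record Matroid (m : ℕ) : Set₁ where
  field
    Indep : Subset m → Set
    indep? : Decidable Indep
    indep-∅ : Indep ⊥
    indep-⊆ : ∀ {X Y} → X ⊆ Y → Indep Y → Indep X
    indep-aug : ∀ {X Y} → Indep X → Indep Y → ∣ X ∣ < ∣ Y ∣ →
                ∃[ e ] (e ∈ Y × e ∉ X × Indep (X ∪ ⁅ e ⁆))
    loopless : ∀ e → Indep ⁅ e ⁆

subsets : (m : ℕ) → List (Subset m)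
subsets zero = [] ∷ []
subsets (suc m) = map (true ∷_) (subsets m) ++ map (false ∷_) (subsets m)

maxList : List ℕ → ℕ
maxList = foldr _⊔_ 0

module _ {m : ℕ} (M : Matroid m) where
  open Matroid M

  rank : Subset m → ℕ
  rank X = maxList (map ∣_∣ (filter (λ Y → (Y ⊆? X) ×-dec indep? Y) (subsets m)))

  rankM : ℕ
  rankM = rank ⊤

  IsBase : Subset m → Set
  IsBase B = Indep B × (∀ e → e ∉ B → ¬ Indep (B ∪ ⁅ e ⁆))

  isBase? : Decidable IsBase
  isBase? B = indep? B ×-dec all? (λ e → ¬? (e ∈? B) →-dec ¬? (indep? (B ∪ ⁅ e ⁆)))

module _ (G : FinAbGroup) where
  open FinAbGroup G

  labelSum : {m : ℕ} → (Fin m → Fin n) → Subset m → Fin n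
  labelSum ℓ [] = 𝟘
  labelSum ℓ (true ∷ F) = ℓ zero ⊕ labelSum (λ e → ℓ (suc e)) F
  labelSum ℓ (false ∷ F) = labelSum (λ e → ℓ (suc e)) F

  labelImage : {m : ℕ} → Matroid m → (Fin m → Fin n) → Subset n
  labelImage {m} M ℓ = tabulate λ g →
    does (Any.any? (λ B → isBase? M B ×-dec (labelSum ℓ B ≟ g)) (subsets m))

  stab : Subgroup G → Subset n → Subset n
  stab K A = tabulate λ h → does
    ((h ∈? Subgroup.carrier K)
     ×-dec all? (λ a → (a ∈? A) →-dec ((h ⊕ a) ∈? A))
     ×-dec all? (λ a → (a ∈? A) →-dec any? (λ b → (b ∈? A) ×-dec ((h ⊕ b) ≟ a))))

  coset : Fin n → Subset n → Subset n
  coset g H = tabulate λ x → does (any? (λ h → (h ∈? H) ×-dec ((g ⊕ h) ≟ x)))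

  IsRep : Subset n → Fin n → Set
  IsRep H g = ∀ h → h ∈ H → toℕ g ≤ toℕ (g ⊕ h)

  isRep? : (H : Subset n) → Decidable (IsRep H)
  isRep? H g = all? (λ h → (h ∈? H) →-dec (toℕ g Data.Nat.≤? toℕ (g ⊕ h)))

  preimage : {m : ℕ} → (Fin m → Fin n) → Subset n → Subset m
  preimage ℓ S = tabulate λ e → does (ℓ e ∈? S)

  -- Σ_{Q ∈ K/H} r(E(Q)); each coset Q of H in K is enumerated once via
  -- its canonical representative g ∈ K.
  cosetRankSum : {m : ℕ} → Matroid m → (Fin m → Fin n) →
                 Subgroup G → Subset n → ℕ
  cosetRankSum M ℓ K H =
    sum (map (λ g → rank M (preimage ℓ (coset g H)))
             (filter (λ g → (g ∈? Subgroup.carrier K) ×-dec isRep? H g) (allFin n)))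

-- natural-number division (divisor 0 never occurs below, |H| ≥ 1)
_div_ : ℕ → ℕ → ℕ
a div zero = 0
a div suc b = a / suc b

SchrijverSeymour : (G : FinAbGroup) → Subgroup G → Set₁
SchrijverSeymour G K =
  ∀ (m : ℕ) (M : Matroid m) (ℓ : Fin m → Fin n) →
  (∀ e → ℓ e ∈ Subgroup.carrier K) →
  let LM = labelImage G M ℓ
      H  = stab G K LM
  in ∣ H ∣ * ((cosetRankSum G M ℓ K H + 1 ∸ rankM M) ⊓ (∣ Subgroup.carrier K ∣ div ∣ H ∣))
     ≤ ∣ LM ∣
  where open FinAbGroup G

KClose : FinAbGroup → ℕ → Set₁
KClose G k =
  ∀ (m : ℕ) (M : Matroid m) (ℓ : Fin m → Fin n) (g : Fin n) →
  (∃[ B ] (IsBase M B × labelSum G ℓ B ≡ g)) →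
  ∀ A → IsBase M A →
  ∃[ B ] (IsBase M B × labelSum G ℓ B ≡ g × ∣ A ─ B ∣ ≤ k)
  where open FinAbGroup G

{-# OPTIONS --safe #-}
module Submission where

-- Let A be a base and B a g-base with ∣ A ─ B ∣ ≥ ∣ K ∣, where K is a subgroup containing the labels
-- on A △ B; it suffices to find another base of the same label between A ∩ B and A ∪ B. Fix b ∈ B ─ A and
-- let N be the minor (M / (A ∩ B)) restricted to (A △ B) - b. If N has a base with label ℓ(B ─ A), it
-- yields the new base. Otherwise ∣ ℓ(N) ∣ < ∣ K ∣, so H = stab ℓ(N) is a proper subgroup and the
-- Schrijver–Seymour bound forces Σ_Q r(E(Q)) < r(N) + ∣ K / H ∣ - 1. By submodularity, some coset Q then
-- contains ∣ H ∣ elements of A ─ B that can simultaneously replace elements of B ─ A from the same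
-- coset. After translating the labels by Q into H, induction on the subgroup finishes the proof.

open import Defs
open import Algebra.Bundles using (AbelianGroup)
import Algebra.Properties.AbelianGroup as AbelianGroupProperties
open import Algebra.Structures using (IsAbelianGroup)
open import Data.Bool using (Bool; true; false; if_then_else_)
open import Data.Empty using (⊥-elim)
open import Data.Fin using (Fin; zero; suc; toℕ)
import Data.Fin.Properties as Fin
open import Data.Fin.Subset using (Subset; _∈_; _∉_; ⁅_⁆; _∪_; _∩_; _─_; _-_; ∣_∣; _⊆_; ⊥; Nonempty)
open import Data.Fin.Subset.Properties
open import Data.List using (List; []; _∷_; map; filter; allFin; length)
import Data.List.Membership.Propositional as List
import Data.List.Membership.Propositional.Properties as List
open import Data.List.Properties using (map-cong)
open import Data.List.Relation.Unary.All as All using ()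
open import Data.List.Relation.Unary.AllPairs using (_∷_)
open import Data.List.Relation.Unary.Any as Any using (here; there)
open import Data.List.Relation.Unary.Unique.Propositional using (Unique)
import Data.List.Relation.Unary.Unique.Propositional.Properties as Unique
open import Data.Nat using (ℕ; zero; suc; _+_; _*_; _∸_; _⊓_; _≤_; _<_; z≤n; s≤s; _≤?_; _<?_)
open import Data.Nat.DivMod using (m*n/n≡m)
open import Data.Nat.Induction using (<-wellFounded)
open import Data.Nat.ListAction using (sum)
open import Data.Nat.Properties hiding (_≤?_; _<?_)
open import Algebra.Properties.CommutativeSemigroup +-commutativeSemigroup using () renaming (interchange to +-interchange)
open import Data.Nat.Solver using (module +-*-Solver)
open import Data.Product using (∃-syntax; _×_; _,_; proj₁; proj₂)
open import Data.Sum as Sum using (_⊎_; inj₁; inj₂; [_,_]′)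
open import Data.Vec using ([]; _∷_; tabulate; here; there)
open import Data.Vec.Properties using (lookup∘tabulate; []=⇒lookup; lookup⇒[]=)
open import Function using (_∘_; id; case_of_)
open import Induction.WellFounded using (Acc; acc)
open import Relation.Binary.PropositionalEquality using (_≡_; _≢_; refl; sym; trans; cong; cong₂; subst; subst₂; module ≡-Reasoning)
open import Relation.Nullary using (¬_; yes; no; does)
open import Relation.Nullary.Decidable using (_×-dec_; _→-dec_; dec-true; dec-false; decidable-stable)
open import Relation.Unary using (Decidable)

-- Finite subsets and their cardinalities

private
  variable
    m k : ℕ
    p q : Subset k

Disjoint : Subset k → Subset k → Set
Disjoint p q = ∀ {x} → x ∈ p → x ∉ q

x∈p─q⁻ : ∀ (p q : Subset k) {x} → x ∈ p ─ q → x ∈ p × x ∉ q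
x∈p─q⁻ (_ ∷ p) (false ∷ q) here      = here , λ ()
x∈p─q⁻ (_ ∷ p) (true ∷ q)  (there x) with x∈p─q⁻ p q x
... | x∈p , x∉q = there x∈p , x∉q ∘ drop-there
x∈p─q⁻ (_ ∷ p) (false ∷ q) (there x) with x∈p─q⁻ p q x
... | x∈p , x∉q = there x∈p , x∉q ∘ drop-there

x∈p-y⁻ : ∀ (p : Subset k) y {x} → x ∈ p - y → x ∈ p × x ≢ y
x∈p-y⁻ p y x∈ with x∈p─q⁻ p ⁅ y ⁆ x∈
... | x∈p , x∉y = x∈p , λ { refl → x∉y (x∈⁅x⁆ y) }

∪-lub : ∀ {p q r : Subset k} → p ⊆ r → q ⊆ r → p ∪ q ⊆ r
∪-lub {p = p} {q = q} p⊆r q⊆r x∈ = [ p⊆r , q⊆r ]′ (x∈p∪q⁻ p q x∈)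

∣∪∣+∣∩∣ : ∀ (p q : Subset k) → ∣ p ∪ q ∣ + ∣ p ∩ q ∣ ≡ ∣ p ∣ + ∣ q ∣
∣∪∣+∣∩∣ []          []          = refl
∣∪∣+∣∩∣ (false ∷ p) (false ∷ q) = ∣∪∣+∣∩∣ p q
∣∪∣+∣∩∣ (false ∷ p) (true ∷ q)  = trans (cong suc (∣∪∣+∣∩∣ p q)) (sym (+-suc ∣ p ∣ ∣ q ∣))
∣∪∣+∣∩∣ (true ∷ p)  (false ∷ q) = cong suc (∣∪∣+∣∩∣ p q)
∣∪∣+∣∩∣ (true ∷ p)  (true ∷ q)  = cong suc (trans (+-suc ∣ p ∪ q ∣ ∣ p ∩ q ∣)
  (trans (cong suc (∣∪∣+∣∩∣ p q)) (sym (+-suc ∣ p ∣ ∣ q ∣))))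

disjoint-tail : ∀ {s t} → Disjoint (s ∷ p) (t ∷ q) → Disjoint p q
disjoint-tail d x∈p x∈q = d (there x∈p) (there x∈q)

disjoint-∣∪∣ : ∀ (p q : Subset k) → Disjoint p q → ∣ p ∪ q ∣ ≡ ∣ p ∣ + ∣ q ∣
disjoint-∣∪∣ []          []          d = refl
disjoint-∣∪∣ (false ∷ p) (false ∷ q) d = disjoint-∣∪∣ p q (disjoint-tail d)
disjoint-∣∪∣ (false ∷ p) (true ∷ q)  d = trans (cong suc (disjoint-∣∪∣ p q (disjoint-tail d))) (sym (+-suc ∣ p ∣ ∣ q ∣))
disjoint-∣∪∣ (true ∷ p)  (false ∷ q) d = cong suc (disjoint-∣∪∣ p q (disjoint-tail d))
disjoint-∣∪∣ (true ∷ p)  (true ∷ q)  d = ⊥-elim (d here here)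

p⊆q⇒p∪[q─p]≡q : p ⊆ q → p ∪ (q ─ p) ≡ q
p⊆q⇒p∪[q─p]≡q {p = p} {q = q} p⊆q = ⊆-antisym (∪-lub p⊆q (p─q⊆p q p)) λ {x} x∈q → x∈p∪q⁺ (case x ∈? p of λ where
  (yes x∈p) → inj₁ x∈p
  (no x∉p)  → inj₂ (x∈p∧x∉q⇒x∈p─q x∈q x∉p))

p∩q∪p─q≡p : ∀ (p q : Subset k) → (p ∩ q) ∪ (p ─ q) ≡ p
p∩q∪p─q≡p []      []          = refl
p∩q∪p─q≡p (false ∷ p) (false ∷ q) = cong (false ∷_) (p∩q∪p─q≡p p q)
p∩q∪p─q≡p (false ∷ p) (true ∷ q)  = cong (false ∷_) (p∩q∪p─q≡p p q)
p∩q∪p─q≡p (true ∷ p)  (false ∷ q) = cong (true ∷_) (p∩q∪p─q≡p p q)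
p∩q∪p─q≡p (true ∷ p)  (true ∷ q)  = cong (true ∷_) (p∩q∪p─q≡p p q)

∩-─-disjoint : ∀ (p q r : Subset k) → Disjoint (p ∩ q) (r ─ q)
∩-─-disjoint p q r x∈∩ x∈─ = proj₂ (x∈p─q⁻ r q x∈─) (proj₂ (x∈p∩q⁻ p q x∈∩))

∣p∩q∣+∣p─q∣ : ∀ (p q : Subset k) → ∣ p ∩ q ∣ + ∣ p ─ q ∣ ≡ ∣ p ∣
∣p∩q∣+∣p─q∣ p q = trans (sym (disjoint-∣∪∣ (p ∩ q) (p ─ q) (∩-─-disjoint p q p))) (cong ∣_∣ (p∩q∪p─q≡p p q))

p⊆q⇒∣p∣+∣q─p∣ : p ⊆ q → ∣ p ∣ + ∣ q ─ p ∣ ≡ ∣ q ∣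
p⊆q⇒∣p∣+∣q─p∣ {p = p} {q = q} p⊆q =
  trans (sym (disjoint-∣∪∣ p (q ─ p) λ x∈p x∈─ → proj₂ (x∈p─q⁻ q p x∈─) x∈p)) (cong ∣_∣ (p⊆q⇒p∪[q─p]≡q p⊆q))

∣p-x∣ : ∀ {x} → x ∈ p → suc ∣ p - x ∣ ≡ ∣ p ∣
∣p-x∣ {p = p} {x} x∈p = trans (cong (_+ ∣ p - x ∣) (sym (∣⁅x⁆∣≡1 x)))
  (p⊆q⇒∣p∣+∣q─p∣ λ y∈ → subst (_∈ p) (sym (x∈⁅y⁆⇒x≡y x y∈)) x∈p)

x∉p⇒∣p∪x∣ : ∀ {x} → x ∉ p → ∣ p ∪ ⁅ x ⁆ ∣ ≡ suc ∣ p ∣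
x∉p⇒∣p∪x∣ {p = p} {x} x∉p = trans (disjoint-∣∪∣ p ⁅ x ⁆ λ y∈p y∈x → x∉p (subst (_∈ p) (x∈⁅y⁆⇒x≡y x y∈x) y∈p))
  (trans (cong (∣ p ∣ +_) (∣⁅x⁆∣≡1 x)) (+-comm ∣ p ∣ 1))

p⊆q∧∣q∣≤∣p∣⇒q⊆p : p ⊆ q → ∣ q ∣ ≤ ∣ p ∣ → q ⊆ p
p⊆q∧∣q∣≤∣p∣⇒q⊆p {p = p} p⊆q q≤p {x} x∈q with x ∈? p
... | yes x∈p = x∈p
... | no  x∉p = ⊥-elim (<⇒≱ (p⊂q⇒∣p∣<∣q∣ (p⊆q , x , x∈q , x∉p)) q≤p)

0<∣p∣⇒Nonempty : ∀ (p : Subset k) → 0 < ∣ p ∣ → Nonempty p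
0<∣p∣⇒Nonempty (true ∷ p)  _   = zero , here
0<∣p∣⇒Nonempty (false ∷ p) 0<p with 0<∣p∣⇒Nonempty p 0<p
... | x , x∈p = suc x , there x∈p

-- Induction on `p`: the image of the head is deleted from `q`, and injectivity keeps the images of
-- the tail inside what remains. It serves to compare a coset with its subgroup in both directions.
injection⇒∣p∣≤∣q∣ : (f : Fin m → Fin k) → (∀ {x y} → f x ≡ f y → x ≡ y) →
  (p : Subset m) (q : Subset k) → (∀ {x} → x ∈ p → f x ∈ q) → ∣ p ∣ ≤ ∣ q ∣
injection⇒∣p∣≤∣q∣ f inj []          q p→q = z≤n
injection⇒∣p∣≤∣q∣ f inj (false ∷ p) q p→q =
  injection⇒∣p∣≤∣q∣ (f ∘ suc) (Fin.suc-injective ∘ inj) p q (p→q ∘ there)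
injection⇒∣p∣≤∣q∣ f inj (true ∷ p)  q p→q = ≤-trans
  (s≤s (injection⇒∣p∣≤∣q∣ (f ∘ suc) (Fin.suc-injective ∘ inj) p (q - f zero)
    λ x∈p → x∈p∧x≢y⇒x∈p-y (p→q (there x∈p)) (λ eq → case inj eq of λ ())))
  (≤-reflexive (∣p-x∣ (p→q here)))

module _ {P : Fin k → Set} (P? : Decidable P) where

  ∈-tabulate⁺ : ∀ {x} → P x → x ∈ tabulate (does ∘ P?)
  ∈-tabulate⁺ {x} Px = lookup⇒[]= x _ (trans (lookup∘tabulate _ x) (dec-true (P? x) Px))

  ∈-tabulate⁻ : ∀ {x} → x ∈ tabulate (does ∘ P?) → P x
  ∈-tabulate⁻ {x} x∈ with P? x | trans (sym (lookup∘tabulate (does ∘ P?) x)) ([]=⇒lookup x∈)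
  ... | yes Px | _ = Px

-- Reindexing the subsets of S by Fin ∣ S ∣

embedElem : (S : Subset k) → Fin ∣ S ∣ → Fin k
embedElem (true ∷ S)  zero    = zero
embedElem (true ∷ S)  (suc i) = suc (embedElem S i)
embedElem (false ∷ S) i       = suc (embedElem S i)

embed : (S : Subset k) → Subset ∣ S ∣ → Subset k
embed []          X       = []
embed (true ∷ S)  (x ∷ X) = x ∷ embed S X
embed (false ∷ S) X       = false ∷ embed S X

restrict : (S : Subset k) → Subset k → Subset ∣ S ∣
restrict []          Y       = []
restrict (true ∷ S)  (y ∷ Y) = y ∷ restrict S Y
restrict (false ∷ S) (_ ∷ Y) = restrict S Y

∣embed∣ : ∀ (S : Subset k) X → ∣ embed S X ∣ ≡ ∣ X ∣
∣embed∣ []          []          = refl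
∣embed∣ (true ∷ S)  (true ∷ X)  = cong suc (∣embed∣ S X)
∣embed∣ (true ∷ S)  (false ∷ X) = ∣embed∣ S X
∣embed∣ (false ∷ S) X           = ∣embed∣ S X

embed-∪ : ∀ (S : Subset k) X Y → embed S (X ∪ Y) ≡ embed S X ∪ embed S Y
embed-∪ []          X       Y       = refl
embed-∪ (true ∷ S)  (_ ∷ X) (_ ∷ Y) = cong (_ ∷_) (embed-∪ S X Y)
embed-∪ (false ∷ S) X       Y       = cong (false ∷_) (embed-∪ S X Y)

embed-⊥ : ∀ (S : Subset k) → embed S ⊥ ≡ ⊥
embed-⊥ []          = refl
embed-⊥ (true ∷ S)  = cong (false ∷_) (embed-⊥ S)
embed-⊥ (false ∷ S) = cong (false ∷_) (embed-⊥ S)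

embed-⁅⁆ : ∀ (S : Subset k) i → embed S ⁅ i ⁆ ≡ ⁅ embedElem S i ⁆
embed-⁅⁆ (true ∷ S)  zero    = cong (true ∷_) (embed-⊥ S)
embed-⁅⁆ (true ∷ S)  (suc i) = cong (false ∷_) (embed-⁅⁆ S i)
embed-⁅⁆ (false ∷ S) i       = cong (false ∷_) (embed-⁅⁆ S i)

embedElem∈ : ∀ (S : Subset k) i → embedElem S i ∈ S
embedElem∈ (true ∷ S)  zero    = here
embedElem∈ (true ∷ S)  (suc i) = there (embedElem∈ S i)
embedElem∈ (false ∷ S) i       = there (embedElem∈ S i)

∈-embed⁺ : ∀ (S : Subset k) {X i} → i ∈ X → embedElem S i ∈ embed S X
∈-embed⁺ (true ∷ S)  here       = here
∈-embed⁺ (true ∷ S)  (there i∈) = there (∈-embed⁺ S i∈)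
∈-embed⁺ (false ∷ S) i∈         = there (∈-embed⁺ S i∈)

∈-embed⁻ : ∀ (S : Subset k) {X x} → x ∈ embed S X → ∃[ i ] i ∈ X × x ≡ embedElem S i
∈-embed⁻ (true ∷ S)  {_ ∷ X} here       = zero , here , refl
∈-embed⁻ (true ∷ S)  {_ ∷ X} (there x∈) with ∈-embed⁻ S x∈
... | i , i∈ , eq = suc i , there i∈ , cong suc eq
∈-embed⁻ (false ∷ S) (there x∈)         with ∈-embed⁻ S x∈
... | i , i∈ , eq = i , i∈ , cong suc eq

embed⊆ : ∀ (S : Subset k) X → embed S X ⊆ S
embed⊆ S X x∈ with ∈-embed⁻ S x∈
... | i , _ , refl = embedElem∈ S i

embed-mono : ∀ (S : Subset k) {X Y} → X ⊆ Y → embed S X ⊆ embed S Y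
embed-mono S X⊆Y x∈ with ∈-embed⁻ S x∈
... | _ , i∈ , refl = ∈-embed⁺ S (X⊆Y i∈)

∈-restrict⁻ : ∀ (S : Subset k) {Y i} → i ∈ restrict S Y → embedElem S i ∈ Y
∈-restrict⁻ (true ∷ S)  {_ ∷ Y} here       = here
∈-restrict⁻ (true ∷ S)  {_ ∷ Y} (there i∈) = there (∈-restrict⁻ S i∈)
∈-restrict⁻ (false ∷ S) {_ ∷ Y} i∈         = there (∈-restrict⁻ S i∈)

embed-restrict : ∀ (S : Subset k) {Y} → Y ⊆ S → embed S (restrict S Y) ≡ Y
embed-restrict []          {[]}        Y⊆S = refl
embed-restrict (true ∷ S)  {_ ∷ Y}     Y⊆S = cong (_ ∷_) (embed-restrict S (drop-∷-⊆ Y⊆S))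
embed-restrict (false ∷ S) {false ∷ Y} Y⊆S = cong (false ∷_) (embed-restrict S (drop-∷-⊆ Y⊆S))
embed-restrict (false ∷ S) {true ∷ Y}  Y⊆S with () ← Y⊆S here

-- Rank and bases

∈-subsets : ∀ (X : Subset k) → X List.∈ subsets k
∈-subsets []          = here refl
∈-subsets {suc k} (true ∷ X)  = List.∈-++⁺ˡ (List.∈-map⁺ (true ∷_) (∈-subsets X))
∈-subsets {suc k} (false ∷ X) = List.∈-++⁺ʳ (map (true ∷_) (subsets k)) (List.∈-map⁺ (false ∷_) (∈-subsets X))

∈⇒≤maxList : ∀ {x xs} → x List.∈ xs → x ≤ maxList xs
∈⇒≤maxList {xs = y ∷ xs} (here refl) = m≤m⊔n y (maxList xs)
∈⇒≤maxList {xs = y ∷ xs} (there x∈)  = m≤n⇒m≤o⊔n y (∈⇒≤maxList x∈)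

maxList-sel : ∀ xs → maxList xs ≡ 0 ⊎ maxList xs List.∈ xs
maxList-sel []       = inj₁ refl
maxList-sel (y ∷ xs) with ⊔-sel y (maxList xs) | maxList-sel xs
... | inj₁ eq | _         = inj₂ (here eq)
... | inj₂ eq | inj₁ ≡0   = inj₁ (trans eq ≡0)
... | inj₂ eq | inj₂ max∈ = inj₂ (there (subst (List._∈ xs) (sym eq) max∈))

module _ {m} (M : Matroid m) where
  open Matroid M

  indep⇒∣∣≤rank : ∀ {X Z} → Z ⊆ X → Indep Z → ∣ Z ∣ ≤ rank M X
  indep⇒∣∣≤rank {X} {Z} Z⊆X iZ = ∈⇒≤maxList (List.∈-map⁺ ∣_∣
    (List.∈-filter⁺ (λ Y → (Y ⊆? X) ×-dec indep? Y) (∈-subsets Z) ((λ {x} → Z⊆X {x}) , iZ)))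

  rank-attained : ∀ X → ∃[ Z ] Z ⊆ X × Indep Z × ∣ Z ∣ ≡ rank M X
  rank-attained X with maxList-sel (map ∣_∣ (filter (λ Y → (Y ⊆? X) ×-dec indep? Y) (subsets m)))
  -- The value 0 may be only the default of `maxList`, so no list entry is available as a witness;
  -- the empty set attains it.
  ... | inj₁ ≡0   = ⊥ , ⊥⊆ , indep-∅ , trans (∣⊥∣≡0 m) (sym ≡0)
  ... | inj₂ max∈ with List.∈-map⁻ ∣_∣ max∈
  ... | Z , Z∈ , eq with List.∈-filter⁻ (λ Y → (Y ⊆? X) ×-dec indep? Y) {xs = subsets m} Z∈
  ... | _ , Z⊆X , iZ = Z , (λ {x} → Z⊆X {x}) , iZ , sym eq

  rank≤ : ∀ {X k} → (∀ {Z} → Z ⊆ X → Indep Z → ∣ Z ∣ ≤ k) → rank M X ≤ k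
  rank≤ {X} bound with rank-attained X
  ... | Z , Z⊆X , iZ , eq = subst (_≤ _) eq (bound Z⊆X iZ)

  extend : ∀ {I X} → I ⊆ X → Indep I → ∃[ J ] I ⊆ J × J ⊆ X × Indep J × ∣ J ∣ ≡ rank M X
  extend {I} {X} I⊆X iI = go _ I⊆X iI (m+[n∸m]≡n (indep⇒∣∣≤rank I⊆X iI))
    where
    -- `k` counts the elements still missing. While it is positive, a maximum independent subset of
    -- `X` is larger than `I` and supplies an augmenting element.
    go : ∀ k {I} → I ⊆ X → Indep I → ∣ I ∣ + k ≡ rank M X → ∃[ J ] I ⊆ J × J ⊆ X × Indep J × ∣ J ∣ ≡ rank M X
    go zero    {I} I⊆X iI eq = I , id , I⊆X , iI , trans (sym (+-identityʳ _)) eq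
    go (suc k) {I} I⊆X iI eq with rank-attained X
    ... | Z , Z⊆X , iZ , ∣Z∣≡ with indep-aug iI iZ (subst (∣ I ∣ <_) (trans eq (sym ∣Z∣≡)) (m<m+n ∣ I ∣ (s≤s z≤n)))
    ... | e , e∈Z , e∉I , iIe with go k (∪-lub I⊆X (λ x∈ → subst (_∈ X) (sym (x∈⁅y⁆⇒x≡y e x∈)) (Z⊆X e∈Z))) iIe
                                  (trans (cong (_+ k) (x∉p⇒∣p∪x∣ e∉I)) (trans (sym (+-suc ∣ I ∣ k)) eq))
    ... | J , Ie⊆J , J⊆X , iJ , ∣J∣≡ = J , Ie⊆J ∘ p⊆p∪q ⁅ e ⁆ , J⊆X , iJ , ∣J∣≡

  -- Extend `I` to a maximum independent `J` in `X ∪ Y`, so that `∣ Z ∣ ≤ ∣ J ∣`. The traces of `J`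
  -- on `X` and `Y` cover `J` and both contain `I`, so their sizes add up to at least
  -- `∣ J ∣ + ∣ I ∣`.
  rank-submodular : ∀ {I Z X Y} → Indep I → Indep Z → I ⊆ X → I ⊆ Y → Z ⊆ X ∪ Y →
    ∣ Z ∣ + ∣ I ∣ ≤ rank M X + rank M Y
  rank-submodular {I} {Z} {X} {Y} iI iZ I⊆X I⊆Y Z⊆ with extend (p⊆p∪q Y ∘ I⊆X) iI
  ... | J , I⊆J , J⊆ , iJ , ∣J∣≡ = begin
    ∣ Z ∣ + ∣ I ∣                                          ≤⟨ +-monoˡ-≤ ∣ I ∣ (indep⇒∣∣≤rank Z⊆ iZ) ⟩
    rank M (X ∪ Y) + ∣ I ∣                                 ≡⟨ cong (_+ ∣ I ∣) (sym ∣J∣≡) ⟩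
    ∣ J ∣ + ∣ I ∣                                          ≤⟨ +-mono-≤ (p⊆q⇒∣p∣≤∣q∣ J⊆∪) (p⊆q⇒∣p∣≤∣q∣ I⊆∩) ⟩
    ∣ (J ∩ X) ∪ (J ∩ Y) ∣ + ∣ (J ∩ X) ∩ (J ∩ Y) ∣          ≡⟨ ∣∪∣+∣∩∣ (J ∩ X) (J ∩ Y) ⟩
    ∣ J ∩ X ∣ + ∣ J ∩ Y ∣                                  ≤⟨ +-mono-≤ (trace X) (trace Y) ⟩
    rank M X + rank M Y                                    ∎
    where
    open ≤-Reasoning
    J⊆∪ : J ⊆ (J ∩ X) ∪ (J ∩ Y)
    J⊆∪ x∈J = x∈p∪q⁺ (Sum.map (λ x∈X → x∈p∩q⁺ (x∈J , x∈X)) (λ x∈Y → x∈p∩q⁺ (x∈J , x∈Y)) (x∈p∪q⁻ X Y (J⊆ x∈J)))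
    I⊆∩ : I ⊆ (J ∩ X) ∩ (J ∩ Y)
    I⊆∩ x∈I = x∈p∩q⁺ (x∈p∩q⁺ (I⊆J x∈I , I⊆X x∈I) , x∈p∩q⁺ (I⊆J x∈I , I⊆Y x∈I))
    trace : ∀ V → ∣ J ∩ V ∣ ≤ rank M V
    trace V = indep⇒∣∣≤rank (p∩q⊆q J V) (indep-⊆ (p∩q⊆p J V) iJ)

  -- `IsBase` only demands maximality under inclusion. A strictly larger independent set would
  -- augment `B`, so the maximality is also one of cardinality.
  base-max : ∀ {B Z} → IsBase M B → Indep Z → ∣ Z ∣ ≤ ∣ B ∣
  base-max {B} {Z} (iB , max) iZ with ∣ Z ∣ ≤? ∣ B ∣
  ... | yes Z≤B = Z≤B
  ... | no  Z≰B with indep-aug iB iZ (≰⇒> Z≰B)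
  ... | e , _ , e∉B , iBe = ⊥-elim (max e e∉B iBe)

  base-∣∣ : ∀ {A B} → IsBase M A → IsBase M B → ∣ A ∣ ≡ ∣ B ∣
  base-∣∣ A-base B-base = ≤-antisym (base-max B-base (proj₁ A-base)) (base-max A-base (proj₁ B-base))

  base-∣─∣ : ∀ {A B} → IsBase M A → IsBase M B → ∣ A ─ B ∣ ≡ ∣ B ─ A ∣
  base-∣─∣ {A} {B} A-base B-base = +-cancelˡ-≡ ∣ A ∩ B ∣ _ _ (begin
    ∣ A ∩ B ∣ + ∣ A ─ B ∣  ≡⟨ ∣p∩q∣+∣p─q∣ A B ⟩
    ∣ A ∣                  ≡⟨ base-∣∣ A-base B-base ⟩
    ∣ B ∣                  ≡⟨ sym (∣p∩q∣+∣p─q∣ B A) ⟩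
    ∣ B ∩ A ∣ + ∣ B ─ A ∣  ≡⟨ cong (λ Z → ∣ Z ∣ + ∣ B ─ A ∣) (∩-comm B A) ⟩
    ∣ A ∩ B ∣ + ∣ B ─ A ∣  ∎)
    where open ≡-Reasoning

  ∣base∣≤⇒base : ∀ {B Z} → IsBase M B → Indep Z → ∣ B ∣ ≤ ∣ Z ∣ → IsBase M Z
  ∣base∣≤⇒base B-base iZ B≤Z = iZ , λ e e∉Z iZe →
    <⇒≱ (≤-reflexive (sym (x∉p⇒∣p∪x∣ e∉Z))) (≤-trans (base-max B-base iZe) B≤Z)

  -- Submodularity for C ∪ (P ∪ D) and P ∪ (B ─ D), which together contain B and both contain C ∪ P.
  exchange-or-independent : ∀ {B P D C} h → IsBase M B → Disjoint P B → D ⊆ B → C ⊆ B → Disjoint C D →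
    Indep (C ∪ P) →
    (∃[ A₁ ] A₁ ⊆ P × Indep (A₁ ∪ (B ─ D)) × h ≤ ∣ A₁ ∣) ⊎
    (∃[ J ] C ⊆ J × J ⊆ C ∪ (P ∪ D) × Indep J × ∣ C ∣ + (∣ P ∣ + ∣ D ∣) ≤ ∣ J ∣ + (h ∸ 1))
  exchange-or-independent {B} {P} {D} {C} h B-base P∥B D⊆B C⊆B C∥D iCP
    -- `J₁` attains the rank of `P ∪ (B ─ D)` and contains `B ─ D`, so everything it adds comes from
    -- `P`. `J` attains the rank of `C ∪ (P ∪ D)`.
    with extend {B ─ D} {P ∪ (B ─ D)} (q⊆p∪q P (B ─ D)) (indep-⊆ (p─q⊆p B D) (proj₁ B-base))
       | extend {C ∪ P} {C ∪ (P ∪ D)} (∪-lub (p⊆p∪q (P ∪ D)) (q⊆p∪q C (P ∪ D) ∘ p⊆p∪q D)) iCP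
  ... | J₁ , B─D⊆J₁ , J₁⊆ , iJ₁ , ∣J₁∣≡ | J , CP⊆J , J⊆ , iJ , ∣J∣≡ with h ≤? ∣ J₁ ─ (B ─ D) ∣
  ... | yes h≤ = inj₁ (J₁ ─ (B ─ D) , A₁⊆P , indep-⊆ (∪-lub (p─q⊆p J₁ (B ─ D)) B─D⊆J₁) iJ₁ , h≤)
    where
    A₁⊆P : J₁ ─ (B ─ D) ⊆ P
    A₁⊆P x∈ with x∈p─q⁻ J₁ (B ─ D) x∈
    ... | x∈J₁ , x∉ = [ id , ⊥-elim ∘ x∉ ]′ (x∈p∪q⁻ P (B ─ D) (J₁⊆ x∈J₁))
  ... | no h≰ = inj₂ (J , CP⊆J ∘ p⊆p∪q P , J⊆ , iJ , +-cancelˡ-≤ ∣ B ∣ _ _ bound)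
    where
    open ≤-Reasoning
    A₁ = J₁ ─ (B ─ D)
    CP∥ : Disjoint C P
    CP∥ x∈C x∈P = P∥B x∈P (C⊆B x∈C)
    -- Hence the rank of `P ∪ (B ─ D)` exceeds `∣ B ─ D ∣` by at most `h ∸ 1`; submodularity passes
    -- this on to `J` as a lower bound.
    ∣A₁∣≤ : ∣ A₁ ∣ ≤ h ∸ 1
    ∣A₁∣≤ = <⇒≤pred (≰⇒> h≰)
    B⊆ : B ⊆ (C ∪ (P ∪ D)) ∪ (P ∪ (B ─ D))
    B⊆ {x} x∈B with x ∈? D
    ... | yes x∈D = p⊆p∪q (P ∪ (B ─ D)) (q⊆p∪q C (P ∪ D) (q⊆p∪q P D x∈D))
    ... | no  x∉D = q⊆p∪q (C ∪ (P ∪ D)) (P ∪ (B ─ D)) (q⊆p∪q P (B ─ D) (x∈p∧x∉q⇒x∈p─q x∈B x∉D))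
    CP⊆ : C ∪ P ⊆ P ∪ (B ─ D)
    CP⊆ = ∪-lub (λ x∈C → q⊆p∪q P (B ─ D) (x∈p∧x∉q⇒x∈p─q (C⊆B x∈C) (C∥D x∈C))) (p⊆p∪q (B ─ D))
    bound : ∣ B ∣ + (∣ C ∣ + (∣ P ∣ + ∣ D ∣)) ≤ ∣ B ∣ + (∣ J ∣ + (h ∸ 1))
    bound = begin
      ∣ B ∣ + (∣ C ∣ + (∣ P ∣ + ∣ D ∣))                    ≡⟨ cong (∣ B ∣ +_) (sym (+-assoc (∣ C ∣) (∣ P ∣) (∣ D ∣))) ⟩
      ∣ B ∣ + ((∣ C ∣ + ∣ P ∣) + ∣ D ∣)                    ≡⟨ cong (λ z → ∣ B ∣ + (z + ∣ D ∣)) (sym (disjoint-∣∪∣ C P CP∥)) ⟩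
      ∣ B ∣ + (∣ C ∪ P ∣ + ∣ D ∣)                          ≡⟨ sym (+-assoc (∣ B ∣) (∣ C ∪ P ∣) (∣ D ∣)) ⟩
      (∣ B ∣ + ∣ C ∪ P ∣) + ∣ D ∣                          ≤⟨ +-monoˡ-≤ ∣ D ∣ (rank-submodular iCP (proj₁ B-base) (J⊆ ∘ CP⊆J) CP⊆ B⊆) ⟩
      (rank M (C ∪ (P ∪ D)) + rank M (P ∪ (B ─ D))) + ∣ D ∣ ≡⟨ cong₂ (λ u v → (u + v) + ∣ D ∣) (sym ∣J∣≡) (sym ∣J₁∣≡) ⟩
      (∣ J ∣ + ∣ J₁ ∣) + ∣ D ∣                              ≡⟨ cong (λ z → (∣ J ∣ + z) + ∣ D ∣) (sym (p⊆q⇒∣p∣+∣q─p∣ B─D⊆J₁)) ⟩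
      (∣ J ∣ + (∣ B ─ D ∣ + ∣ A₁ ∣)) + ∣ D ∣                ≡⟨ rearrange (∣ J ∣) (∣ B ─ D ∣) (∣ A₁ ∣) (∣ D ∣) ⟩
      (∣ D ∣ + ∣ B ─ D ∣) + (∣ J ∣ + ∣ A₁ ∣)                ≡⟨ cong (_+ (∣ J ∣ + ∣ A₁ ∣)) (p⊆q⇒∣p∣+∣q─p∣ D⊆B) ⟩
      ∣ B ∣ + (∣ J ∣ + ∣ A₁ ∣)                              ≤⟨ +-monoʳ-≤ ∣ B ∣ (+-monoʳ-≤ ∣ J ∣ ∣A₁∣≤) ⟩
      ∣ B ∣ + (∣ J ∣ + (h ∸ 1))                             ∎
      where
      open +-*-Solver
      rearrange : ∀ j b a d → (j + (b + a)) + d ≡ (d + b) + (j + a)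
      rearrange = solve 4 (λ j b a d → (j :+ (b :+ a)) :+ d := (d :+ b) :+ (j :+ a)) refl

-- Minors and their bases

module _ {m} (M : Matroid m) where
  open Matroid M

  module Minor {S C : Subset m} (S∥C : Disjoint S C) (iC : Indep C) (iCe : ∀ {e} → e ∈ S → Indep (C ∪ ⁅ e ⁆)) where

    lift : Subset ∣ S ∣ → Subset m
    lift X = C ∪ embed S X

    ∣lift∣ : ∀ X → ∣ lift X ∣ ≡ ∣ C ∣ + ∣ X ∣
    ∣lift∣ X = trans (disjoint-∣∪∣ C (embed S X) λ x∈C x∈ → S∥C (embed⊆ S X x∈) x∈C) (cong (∣ C ∣ +_) (∣embed∣ S X))

    lift-mono : ∀ {X Y} → X ⊆ Y → lift X ⊆ lift Y
    lift-mono {X} {Y} X⊆Y = ∪-lub (p⊆p∪q (embed S Y)) (q⊆p∪q C (embed S Y) ∘ embed-mono S X⊆Y)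

    lift-restrict : ∀ {J} → C ⊆ J → J ⊆ C ∪ S → lift (restrict S (J ─ C)) ≡ J
    lift-restrict {J} C⊆J J⊆ = trans (cong (C ∪_) (embed-restrict S J─C⊆S)) (p⊆q⇒p∪[q─p]≡q C⊆J)
      where
      J─C⊆S : J ─ C ⊆ S
      J─C⊆S x∈ with x∈p─q⁻ J C x∈
      ... | x∈J , x∉C = [ ⊥-elim ∘ x∉C , id ]′ (x∈p∪q⁻ C S (J⊆ x∈J))

    -- The contraction of `C` followed by restriction to `S`. As `C` is independent, independence
    -- after contraction can be tested by adding `C` back; `iCe` is what makes the minor loopless.
    minor : Matroid ∣ S ∣
    minor = record
      { Indep     = Indep ∘ lift
      ; indep?    = indep? ∘ lift
      ; indep-∅   = subst Indep (sym (trans (cong (C ∪_) (embed-⊥ S)) (∪-identityʳ C))) iC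
      ; indep-⊆   = λ X⊆Y → indep-⊆ (lift-mono X⊆Y)
      ; indep-aug = aug
      ; loopless  = λ e → subst Indep (cong (C ∪_) (sym (embed-⁅⁆ S e))) (iCe (embedElem∈ S e))
      }
      where
      aug : ∀ {X Y} → Indep (lift X) → Indep (lift Y) → ∣ X ∣ < ∣ Y ∣ →
            ∃[ e ] (e ∈ Y × e ∉ X × Indep (lift (X ∪ ⁅ e ⁆)))
      aug {X} {Y} iX iY X<Y
        with indep-aug iX iY (subst₂ _<_ (sym (∣lift∣ X)) (sym (∣lift∣ Y)) (+-monoʳ-< ∣ C ∣ X<Y))
      ... | e , e∈Y , e∉X , iXe with x∈p∪q⁻ C (embed S Y) e∈Y
      -- The augmenting element is outside `lift X`, which already contains `C`, so it must come
      -- from `Y`.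
      ... | inj₁ e∈C = ⊥-elim (e∉X (p⊆p∪q (embed S X) e∈C))
      ... | inj₂ e∈Y with ∈-embed⁻ S e∈Y
      ... | i , i∈Y , refl = i , i∈Y , (λ i∈X → e∉X (q⊆p∪q C (embed S X) (∈-embed⁺ S i∈X))) ,
        subst Indep (trans (∪-assoc C (embed S X) ⁅ _ ⁆) (cong (C ∪_) (sym (trans (embed-∪ S X ⁅ i ⁆) (cong (embed S X ∪_) (embed-⁅⁆ S i)))))) iXe

    restrict-indep : ∀ {J} → C ⊆ J → J ⊆ C ∪ S → Indep J → Matroid.Indep minor (restrict S (J ─ C))
    restrict-indep C⊆J J⊆ = subst Indep (sym (lift-restrict C⊆J J⊆))

    ∣C∣+∣restrict∣ : ∀ {J} → C ⊆ J → J ⊆ C ∪ S → ∣ C ∣ + ∣ restrict S (J ─ C) ∣ ≡ ∣ J ∣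
    ∣C∣+∣restrict∣ C⊆J J⊆ = trans (sym (∣lift∣ _)) (cong ∣_∣ (lift-restrict C⊆J J⊆))

    module _ {A : Subset m} (A-base : IsBase M A) (C⊆A : C ⊆ A) (A⊆ : A ⊆ C ∪ S) where

      -- Since `A` lies between `C` and `C ∪ S`, its trace is independent in the minor. A base of
      -- the minor is at least as large as that trace, so adding `C` gives an independent set as
      -- large as `A`.
      lift-base : ∀ {X} → IsBase minor X → IsBase M (lift X)
      lift-base {X} X-base = ∣base∣≤⇒base M A-base (proj₁ X-base) (begin
        ∣ A ∣                          ≡⟨ sym (∣C∣+∣restrict∣ C⊆A A⊆) ⟩
        ∣ C ∣ + ∣ restrict S (A ─ C) ∣ ≤⟨ +-monoʳ-≤ ∣ C ∣ (base-max minor X-base (restrict-indep C⊆A A⊆ (proj₁ A-base))) ⟩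
        ∣ C ∣ + ∣ X ∣                  ≡⟨ sym (∣lift∣ X) ⟩
        ∣ lift X ∣                     ∎)
        where open ≤-Reasoning

      restrict-base : IsBase minor (restrict S (A ─ C))
      restrict-base = restrict-indep C⊆A A⊆ (proj₁ A-base) , λ e e∉ ind →
        <⇒≱ (≤-reflexive (sym (x∉p⇒∣p∪x∣ e∉))) (+-cancelˡ-≤ ∣ C ∣ _ _ (begin
          ∣ C ∣ + ∣ restrict S (A ─ C) ∪ ⁅ e ⁆ ∣  ≡⟨ sym (∣lift∣ _) ⟩
          ∣ lift (restrict S (A ─ C) ∪ ⁅ e ⁆) ∣   ≤⟨ base-max M A-base ind ⟩
          ∣ A ∣                                   ≡⟨ sym (∣C∣+∣restrict∣ C⊆A A⊆) ⟩
          ∣ C ∣ + ∣ restrict S (A ─ C) ∣          ∎))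
        where open ≤-Reasoning

      rankM-minor≤ : rankM minor ≤ ∣ A ─ C ∣
      rankM-minor≤ = rank≤ minor λ {Z} _ iZ → +-cancelˡ-≤ ∣ C ∣ _ _ (begin
          ∣ C ∣ + ∣ Z ∣      ≡⟨ sym (∣lift∣ Z) ⟩
          ∣ lift Z ∣         ≤⟨ base-max M A-base iZ ⟩
          ∣ A ∣              ≡⟨ sym (p⊆q⇒∣p∣+∣q─p∣ C⊆A) ⟩
          ∣ C ∣ + ∣ A ─ C ∣  ∎)
        where open ≤-Reasoning

-- Nothing of `A ∩ B` is lost in `B′`. Bases have equal size, so `B′ ≢ B` forces an element of `B′`
-- outside `B`; it must lie in `A`, which makes the inclusion of `A ─ B′` in `A ─ B` strict.
intermediate-base-closer : ∀ {m} (M : Matroid m) {A B B′} → IsBase M B → IsBase M B′ → B′ ≢ B →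
  B ∩ A ⊆ B′ → B′ ⊆ A ∪ B → ∣ A ─ B′ ∣ < ∣ A ─ B ∣
intermediate-base-closer M {A} {B} {B′} B-base B′-base B′≢B B∩A⊆B′ B′⊆ = p⊂q⇒∣p∣<∣q∣ (A─B′⊆ , strict)
  where
  A─B′⊆ : A ─ B′ ⊆ A ─ B
  A─B′⊆ x∈ = let x∈A , x∉B′ = x∈p─q⁻ A B′ x∈ in x∈p∧x∉q⇒x∈p─q x∈A λ x∈B → x∉B′ (B∩A⊆B′ (x∈p∩q⁺ (x∈B , x∈A)))
  strict : ∃[ x ] x ∈ A ─ B × x ∉ A ─ B′
  strict with nonempty? (B′ ─ B)
  ... | yes (x , x∈) = let x∈B′ , x∉B = x∈p─q⁻ B′ B x∈ in
    x , x∈p∧x∉q⇒x∈p─q ([ id , ⊥-elim ∘ x∉B ]′ (x∈p∪q⁻ A B (B′⊆ x∈B′))) x∉B , λ x∈A─B′ → proj₂ (x∈p─q⁻ A B′ x∈A─B′) x∈B′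
  ... | no empty = ⊥-elim (B′≢B (⊆-antisym B′⊆B (p⊆q∧∣q∣≤∣p∣⇒q⊆p B′⊆B (≤-reflexive (base-∣∣ M B-base B′-base)))))
    where
    B′⊆B : B′ ⊆ B
    B′⊆B {x} x∈B′ = decidable-stable (x ∈? B) λ x∉B → empty (x , x∈p∧x∉q⇒x∈p─q x∈B′ x∉B)

-- Sums over lists

sum-map-+ : ∀ {A : Set} (f g : A → ℕ) xs → sum (map (λ x → f x + g x) xs) ≡ sum (map f xs) + sum (map g xs)
sum-map-+ f g []       = refl
sum-map-+ f g (x ∷ xs) = trans (cong (f x + g x +_) (sum-map-+ f g xs)) (+-interchange (f x) (g x) _ _)

-- Here `c` is a uniform slack per summand; in the application it is `∣ H ∣ ∸ 1` for each coset.
sum-map-≤ : ∀ {A : Set} (f g : A → ℕ) c xs → (∀ {x} → x List.∈ xs → f x ≤ g x + c) →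
  sum (map f xs) ≤ sum (map g xs) + length xs * c
sum-map-≤ f g c []       f≤g = z≤n
sum-map-≤ f g c (x ∷ xs) f≤g = begin
  f x + sum (map f xs)                              ≤⟨ +-mono-≤ (f≤g (here refl)) (sum-map-≤ f g c xs (f≤g ∘ there)) ⟩
  (g x + c) + (sum (map g xs) + length xs * c)      ≡⟨ +-interchange (g x) c _ _ ⟩
  (g x + sum (map g xs)) + (c + length xs * c)      ∎
  where open ≤-Reasoning

sum-map-const : ∀ {A : Set} (f : A → ℕ) c xs → (∀ {x} → x List.∈ xs → f x ≡ c) → sum (map f xs) ≡ length xs * c
sum-map-const f c []       eq = refl
sum-map-const f c (x ∷ xs) eq = cong₂ _+_ (eq (here refl)) (sum-map-const f c xs (eq ∘ there))

indicator : Bool → ℕ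
indicator b = if b then 1 else 0

∣b∷p∣ : ∀ {n} b (p : Subset n) → ∣ b ∷ p ∣ ≡ indicator b + ∣ p ∣
∣b∷p∣ false p = refl
∣b∷p∣ true  p = refl

module _ {A : Set} {P : A → Set} (P? : Decidable P) where

  sum-indicator-none : ∀ xs → (∀ {x} → x List.∈ xs → ¬ P x) → sum (map (indicator ∘ does ∘ P?) xs) ≡ 0
  sum-indicator-none []       none = refl
  sum-indicator-none (x ∷ xs) none rewrite dec-false (P? x) (none (here refl)) = sum-indicator-none xs (none ∘ there)

  sum-indicator-unique : ∀ {x₀} xs → Unique xs → x₀ List.∈ xs → P x₀ → (∀ {x} → x List.∈ xs → P x → x ≡ x₀) →
    sum (map (indicator ∘ does ∘ P?) xs) ≡ 1
  sum-indicator-unique (x ∷ xs) (x∉xs ∷ _) (here refl) Px₀ only rewrite dec-true (P? x) Px₀ =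
    cong suc (sum-indicator-none xs λ y∈ Py → All.lookup x∉xs y∈ (sym (only (there y∈) Py)))
  sum-indicator-unique (x ∷ xs) (x∉xs ∷ uniq) (there x₀∈) Px₀ only
    rewrite dec-false (P? x) (λ Px → All.lookup x∉xs x₀∈ (only (here refl) Px)) =
    sum-indicator-unique xs uniq x₀∈ Px₀ (only ∘ there)

-- Labels and cosets

module _ (G : FinAbGroup) where
  open FinAbGroup G
  open IsAbelianGroup isAbelianGroup using (assoc; comm; identityˡ; identityʳ)

  abelianGroup : AbelianGroup _ _
  abelianGroup = record { isAbelianGroup = isAbelianGroup }

  open AbelianGroupProperties abelianGroup using (∙-cancelˡ; \\-leftDividesʳ; //-rightDividesˡ; //-rightDividesʳ)
  open import Algebra.Properties.CommutativeSemigroup (AbelianGroup.commutativeSemigroup abelianGroup) using (interchange)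
  open import Algebra.Definitions.RawMonoid (AbelianGroup.rawMonoid abelianGroup) using () renaming (_×_ to _·_)

  ⊕-moveʳ : ∀ {g k x h} → g ⊕ k ≡ x ⊕ h → g ⊕ (k ⊕ (⊖ h)) ≡ x
  ⊕-moveʳ {g} {k} {x} {h} eq = trans (sym (assoc g k (⊖ h))) (trans (cong (_⊕ (⊖ h)) eq) (//-rightDividesʳ h x))

  labelSum-∪ : ∀ {m} (ℓ : Fin m → Fin n) X Y → Disjoint X Y → labelSum G ℓ (X ∪ Y) ≡ labelSum G ℓ X ⊕ labelSum G ℓ Y
  labelSum-∪ ℓ []          []          d = sym (identityˡ 𝟘)
  labelSum-∪ ℓ (false ∷ X) (false ∷ Y) d = labelSum-∪ (ℓ ∘ suc) X Y (disjoint-tail d)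
  labelSum-∪ ℓ (true ∷ X)  (false ∷ Y) d = trans (cong (ℓ zero ⊕_) (labelSum-∪ (ℓ ∘ suc) X Y (disjoint-tail d))) (sym (assoc _ _ _))
  labelSum-∪ ℓ (false ∷ X) (true ∷ Y)  d = trans (cong (ℓ zero ⊕_) (trans (labelSum-∪ (ℓ ∘ suc) X Y (disjoint-tail d)) (comm _ _)))
    (trans (sym (assoc _ _ _)) (comm _ _))
  labelSum-∪ ℓ (true ∷ X)  (true ∷ Y)  d = ⊥-elim (d here here)

  labelSum-embed : ∀ {m} (ℓ : Fin m → Fin n) S X → labelSum G ℓ (embed S X) ≡ labelSum G (ℓ ∘ embedElem S) X
  labelSum-embed ℓ []          []          = refl
  labelSum-embed ℓ (true ∷ S)  (true ∷ X)  = cong (ℓ zero ⊕_) (labelSum-embed (ℓ ∘ suc) S X)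
  labelSum-embed ℓ (true ∷ S)  (false ∷ X) = labelSum-embed (ℓ ∘ suc) S X
  labelSum-embed ℓ (false ∷ S) X           = labelSum-embed (ℓ ∘ suc) S X

  labelSum-∈ : ∀ {m} (K : Subgroup G) (ℓ : Fin m → Fin n) X →
    (∀ {e} → e ∈ X → ℓ e ∈ Subgroup.carrier K) → labelSum G ℓ X ∈ Subgroup.carrier K
  labelSum-∈ K ℓ []          ℓ∈ = Subgroup.𝟘∈ K
  labelSum-∈ K ℓ (true ∷ X)  ℓ∈ = Subgroup.⊕-closed K (ℓ∈ here) (labelSum-∈ K (ℓ ∘ suc) X (ℓ∈ ∘ there))
  labelSum-∈ K ℓ (false ∷ X) ℓ∈ = labelSum-∈ K (ℓ ∘ suc) X (ℓ∈ ∘ there)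

  labelSum-translate : ∀ {m} c (ℓ : Fin m → Fin n) X →
    labelSum G (λ e → c ⊕ ℓ e) X ≡ (∣ X ∣ · c) ⊕ labelSum G ℓ X
  labelSum-translate c ℓ []          = sym (identityˡ 𝟘)
  labelSum-translate c ℓ (false ∷ X) = labelSum-translate c (ℓ ∘ suc) X
  labelSum-translate c ℓ (true ∷ X)  = trans (cong ((c ⊕ ℓ zero) ⊕_) (labelSum-translate c (ℓ ∘ suc) X)) (interchange _ _ _ _)

  -- Translating every label by `c` shifts the label of a set by a multiple of `c` that depends only
  -- on its size. Thus equality of the labels of two bases is insensitive to translation.
  labelSum-untranslate : ∀ {m} c (ℓ : Fin m → Fin n) X Y → ∣ X ∣ ≡ ∣ Y ∣ →
    labelSum G (λ e → c ⊕ ℓ e) X ≡ labelSum G (λ e → c ⊕ ℓ e) Y → labelSum G ℓ X ≡ labelSum G ℓ Y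
  labelSum-untranslate c ℓ X Y ∣X∣≡∣Y∣ eq = ∙-cancelˡ (∣ X ∣ · c) _ _ (begin
    (∣ X ∣ · c) ⊕ labelSum G ℓ X     ≡⟨ sym (labelSum-translate c ℓ X) ⟩
    labelSum G (λ e → c ⊕ ℓ e) X     ≡⟨ eq ⟩
    labelSum G (λ e → c ⊕ ℓ e) Y     ≡⟨ labelSum-translate c ℓ Y ⟩
    (∣ Y ∣ · c) ⊕ labelSum G ℓ Y     ≡⟨ cong (λ k → (k · c) ⊕ labelSum G ℓ Y) (sym ∣X∣≡∣Y∣) ⟩
    (∣ X ∣ · c) ⊕ labelSum G ℓ Y     ∎)
    where open ≡-Reasoning

  module _ {m} (M : Matroid m) (ℓ : Fin m → Fin n) where

    ∈-labelImage⁺ : ∀ {X} → IsBase M X → labelSum G ℓ X ∈ labelImage G M ℓ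
    ∈-labelImage⁺ {X} X-base = ∈-tabulate⁺
      (λ g → Any.any? (λ B → isBase? M B ×-dec (labelSum G ℓ B Fin.≟ g)) (subsets m))
      (List.lose (∈-subsets X) (X-base , refl))

    ∈-labelImage⁻ : ∀ {g} → g ∈ labelImage G M ℓ → ∃[ X ] IsBase M X × labelSum G ℓ X ≡ g
    ∈-labelImage⁻ g∈ = Any.satisfied (∈-tabulate⁻
      (λ g → Any.any? (λ B → isBase? M B ×-dec (labelSum G ℓ B Fin.≟ g)) (subsets m)) g∈)

  module _ (K : Subgroup G) (A : Subset n) where
    open Subgroup K

    Stabilizes : Fin n → Set
    Stabilizes h = h ∈ carrier × (∀ a → a ∈ A → h ⊕ a ∈ A) × (∀ a → a ∈ A → ∃[ b ] b ∈ A × h ⊕ b ≡ a)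

    stabilizes? : Decidable Stabilizes
    stabilizes? h = (h ∈? carrier)
      ×-dec Fin.all? (λ a → (a ∈? A) →-dec ((h ⊕ a) ∈? A))
      ×-dec Fin.all? (λ a → (a ∈? A) →-dec Fin.any? (λ b → (b ∈? A) ×-dec ((h ⊕ b) Fin.≟ a)))

    ∈-stab⁺ : ∀ {h} → Stabilizes h → h ∈ stab G K A
    ∈-stab⁺ = ∈-tabulate⁺ stabilizes?

    ∈-stab⁻ : ∀ {h} → h ∈ stab G K A → Stabilizes h
    ∈-stab⁻ = ∈-tabulate⁻ stabilizes?

    -- Under negation of `h` the inclusions `h ⊕ A ⊆ A` and `A ⊆ h ⊕ A` change places, which gives
    -- closure under inverses.
    stabSubgroup : Subgroup G
    stabSubgroup = record
      { carrier  = stab G K A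
      ; 𝟘∈       = ∈-stab⁺ (𝟘∈ , (λ a a∈ → subst (_∈ A) (sym (identityˡ a)) a∈) , λ a a∈ → a , a∈ , identityˡ a)
      ; ⊕-closed = λ {x} {y} x∈ y∈ → ∈-stab⁺ (closed x y (∈-stab⁻ x∈) (∈-stab⁻ y∈))
      ; ⊖-closed = λ {x} x∈ → ∈-stab⁺ (inverse x (∈-stab⁻ x∈))
      }
      where
      closed : ∀ x y → Stabilizes x → Stabilizes y → Stabilizes (x ⊕ y)
      closed x y (x∈K , x-into , x-onto) (y∈K , y-into , y-onto) =
        ⊕-closed x∈K y∈K ,
        (λ a a∈ → subst (_∈ A) (sym (assoc x y a)) (x-into _ (y-into a a∈))) ,
        λ a a∈ → let b , b∈ , xb≡a = x-onto a a∈ ; c , c∈ , yc≡b = y-onto b b∈ in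
          c , c∈ , trans (assoc x y c) (trans (cong (x ⊕_) yc≡b) xb≡a)
      inverse : ∀ x → Stabilizes x → Stabilizes (⊖ x)
      inverse x (x∈K , into , onto) = ⊖-closed x∈K ,
        (λ a a∈ → let b , b∈ , xb≡a = onto a a∈ in
          subst (_∈ A) (trans (sym (\\-leftDividesʳ x b)) (cong ((⊖ x) ⊕_) xb≡a)) b∈) ,
        λ a a∈ → x ⊕ a , into a a∈ , \\-leftDividesʳ x a

  ∈-coset⁺ : ∀ g {h} (H : Subset n) → h ∈ H → g ⊕ h ∈ coset G g H
  ∈-coset⁺ g {h} H h∈ = ∈-tabulate⁺ (λ x → Fin.any? (λ h → (h ∈? H) ×-dec ((g ⊕ h) Fin.≟ x))) (h , h∈ , refl)

  ∈-coset⁻ : ∀ g {x} (H : Subset n) → x ∈ coset G g H → ∃[ h ] h ∈ H × g ⊕ h ≡ x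
  ∈-coset⁻ g H = ∈-tabulate⁻ (λ x → Fin.any? (λ h → (h ∈? H) ×-dec ((g ⊕ h) Fin.≟ x)))

  coset-shift : ∀ g H {x} → x ∈ coset G g H → (⊖ g) ⊕ x ∈ H
  coset-shift g H x∈ = let h , h∈ , gh≡x = ∈-coset⁻ g H x∈ in
    subst (_∈ H) (trans (sym (\\-leftDividesʳ g h)) (cong ((⊖ g) ⊕_) gh≡x)) h∈

  ∈-preimage⁺ : ∀ {m} (ℓ : Fin m → Fin n) Q {e} → ℓ e ∈ Q → e ∈ preimage G ℓ Q
  ∈-preimage⁺ ℓ Q = ∈-tabulate⁺ (λ e → ℓ e ∈? Q)

  ∈-preimage⁻ : ∀ {m} (ℓ : Fin m → Fin n) Q {e} → e ∈ preimage G ℓ Q → ℓ e ∈ Q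
  ∈-preimage⁻ ℓ Q = ∈-tabulate⁻ (λ e → ℓ e ∈? Q)

  ∣coset∣ : ∀ g H → ∣ coset G g H ∣ ≡ ∣ H ∣
  ∣coset∣ g H = ≤-antisym
    (injection⇒∣p∣≤∣q∣ ((⊖ g) ⊕_) (∙-cancelˡ (⊖ g) _ _) (coset G g H) H (coset-shift g H))
    (injection⇒∣p∣≤∣q∣ (g ⊕_) (∙-cancelˡ g _ _) H (coset G g H) (∈-coset⁺ g H))

  0<∣carrier∣ : (K : Subgroup G) → 0 < ∣ Subgroup.carrier K ∣
  0<∣carrier∣ K = ≤-trans (≤-reflexive (sym (∣⁅x⁆∣≡1 𝟘)))
    (p⊆q⇒∣p∣≤∣q∣ λ x∈ → subst (_∈ Subgroup.carrier K) (sym (x∈⁅y⁆⇒x≡y 𝟘 x∈)) (Subgroup.𝟘∈ K))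

  module Cosets (K Hs : Subgroup G) (H⊆K : Subgroup.carrier Hs ⊆ Subgroup.carrier K) where
    open Subgroup K
    open Subgroup Hs renaming (carrier to H; 𝟘∈ to 𝟘∈H; ⊕-closed to ⊕-closedH; ⊖-closed to ⊖-closedH) using ()

    -- The very list over which `cosetRankSum` runs, so that sums over it match the sum in the
    -- Schrijver-Seymour bound definitionally.
    reps : List (Fin n)
    reps = filter (λ g → (g ∈? carrier) ×-dec isRep? G H g) (allFin n)

    ∈-reps⁻ : ∀ {g} → g List.∈ reps → g ∈ carrier × IsRep G H g
    ∈-reps⁻ g∈ = proj₂ (List.∈-filter⁻ (λ g → (g ∈? carrier) ×-dec isRep? G H g) {xs = allFin n} g∈)

    coset-⊆ : ∀ {g} → g ∈ carrier → coset G g H ⊆ carrier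
    coset-⊆ {g} g∈ x∈ = let h , h∈ , gh≡x = ∈-coset⁻ g H x∈ in subst (_∈ carrier) gh≡x (⊕-closed g∈ (H⊆K h∈))

    -- Descent on the index: if some translate of `x` by `H` has a smaller index, move there and
    -- stay in the same coset; otherwise `x` itself is the representative.
    rep-exists : ∀ x → ∃[ g ] IsRep G H g × x ∈ coset G g H
    rep-exists x = go x (<-wellFounded (toℕ x))
      where
      go : ∀ x → Acc _<_ (toℕ x) → ∃[ g ] IsRep G H g × x ∈ coset G g H
      go x (acc rs) with Fin.any? (λ h → (h ∈? H) ×-dec (toℕ (x ⊕ h) <? toℕ x))
      ... | no  none = x , (λ h h∈ → ≮⇒≥ λ lt → none (h , h∈ , lt)) , subst (_∈ coset G x H) (identityʳ x) (∈-coset⁺ x H 𝟘∈H)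
      ... | yes (h , h∈ , lt) =
        let g , rep , xh∈ = go (x ⊕ h) (rs lt) ; k , k∈ , gk≡xh = ∈-coset⁻ g H xh∈
        in g , rep , subst (_∈ coset G g H) (⊕-moveʳ gk≡xh) (∈-coset⁺ g H (⊕-closedH k∈ (⊖-closedH h∈)))

    coset-difference : ∀ {x} g g′ → x ∈ coset G g H → x ∈ coset G g′ H → ∃[ h ] h ∈ H × g ⊕ h ≡ g′
    coset-difference {x} g g′ x∈ x∈′ =
      let h , h∈ , gh≡x = ∈-coset⁻ g H x∈ ; h′ , h′∈ , g′h′≡x = ∈-coset⁻ g′ H x∈′
      in h ⊕ (⊖ h′) , ⊕-closedH h∈ (⊖-closedH h′∈) , ⊕-moveʳ (trans gh≡x (sym g′h′≡x))

    rep-≤ : ∀ {x g g′} → IsRep G H g → x ∈ coset G g H → x ∈ coset G g′ H → toℕ g ≤ toℕ g′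
    rep-≤ {x} {g} {g′} rep x∈ x∈′ = let h , h∈ , gh≡g′ = coset-difference g g′ x∈ x∈′ in
      subst (λ z → toℕ g ≤ toℕ z) gh≡g′ (rep h h∈)

    -- One coset contains `x` by `rep-exists`. Two representatives whose cosets share `x` are each
    -- at most the other by `rep-≤`, hence equal.
    sum-coset-indicators : ∀ {x} → x ∈ carrier → sum (map (λ g → indicator (does (x ∈? coset G g H))) reps) ≡ 1
    sum-coset-indicators {x} x∈ with rep-exists x
    ... | g , rep , x∈g = sum-indicator-unique (λ g → x ∈? coset G g H) reps
      (Unique.filter⁺ (λ g → (g ∈? carrier) ×-dec isRep? G H g) (Unique.allFin⁺ n))
      (List.∈-filter⁺ (λ g → (g ∈? carrier) ×-dec isRep? G H g) (List.∈-allFin g) (g∈K , rep)) x∈g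
      λ g′∈ x∈g′ → Fin.toℕ-injective (≤-antisym (rep-≤ (proj₂ (∈-reps⁻ g′∈)) x∈g′ x∈g) (rep-≤ rep x∈g x∈g′))
      where
      g∈K : g ∈ carrier
      g∈K = let h , h∈ , gh≡x = ∈-coset⁻ g H x∈g in
        subst (_∈ carrier) (trans (cong (_⊕ (⊖ h)) (sym gh≡x)) (//-rightDividesʳ h g))
          (⊕-closed x∈ (⊖-closed (H⊆K h∈)))

    -- Induction on `T`: each element lands in precisely one coset and so contributes 1 to the sum.
    sum-coset-parts : ∀ {m} (ℓ : Fin m → Fin n) T → (∀ {e} → e ∈ T → ℓ e ∈ carrier) →
      sum (map (λ g → ∣ T ∩ preimage G ℓ (coset G g H) ∣) reps) ≡ ∣ T ∣
    sum-coset-parts ℓ []          ℓ∈ = trans (sum-map-const (λ _ → 0) 0 reps (λ _ → refl)) (*-zeroʳ (length reps))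
    sum-coset-parts ℓ (false ∷ T) ℓ∈ = sum-coset-parts (ℓ ∘ suc) T (ℓ∈ ∘ there)
    sum-coset-parts ℓ (true ∷ T)  ℓ∈ = begin
      sum (map (λ g → ∣ does (ℓ zero ∈? coset G g H) ∷ rest g ∣) reps)
        ≡⟨ cong sum (map-cong (λ g → ∣b∷p∣ (does (ℓ zero ∈? coset G g H)) (rest g)) reps) ⟩
      sum (map (λ g → indicator (does (ℓ zero ∈? coset G g H)) + ∣ rest g ∣) reps)
        ≡⟨ sum-map-+ (λ g → indicator (does (ℓ zero ∈? coset G g H))) (∣_∣ ∘ rest) reps ⟩
      sum (map (λ g → indicator (does (ℓ zero ∈? coset G g H))) reps) + sum (map (∣_∣ ∘ rest) reps)
        ≡⟨ cong₂ _+_ (sum-coset-indicators (ℓ∈ here)) (sum-coset-parts (ℓ ∘ suc) T (ℓ∈ ∘ there)) ⟩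
      suc ∣ T ∣ ∎
      where
      open ≡-Reasoning
      rest : Fin n → Subset _
      rest g = T ∩ preimage G (ℓ ∘ suc) (coset G g H)

    -- Partition `carrier` itself by labeling every group element with itself; each part is a full
    -- coset, of size `∣ H ∣`.
    lagrange : length reps * ∣ H ∣ ≡ ∣ carrier ∣
    lagrange = trans (sym (sum-map-const (λ g → ∣ carrier ∩ preimage G id (coset G g H) ∣) ∣ H ∣ reps part))
      (sum-coset-parts id carrier id)
      where
      part : ∀ {g} → g List.∈ reps → ∣ carrier ∩ preimage G id (coset G g H) ∣ ≡ ∣ H ∣
      part {g} g∈ = trans (cong ∣_∣ (⊆-antisym
        (λ x∈ → ∈-preimage⁻ id (coset G g H) (p∩q⊆q carrier _ x∈))
        (λ x∈ → x∈p∩q⁺ (coset-⊆ (proj₁ (∈-reps⁻ g∈)) x∈ , ∈-preimage⁺ id (coset G g H) x∈)))) (∣coset∣ g H)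

    index : ∣ carrier ∣ div ∣ H ∣ ≡ length reps
    index = div-unique ∣ H ∣ (0<∣carrier∣ Hs) lagrange
      where
      -- Positivity rules out the default clause of `_div_`, leaving genuine division.
      div-unique : ∀ {q a} h → 0 < h → q * h ≡ a → a div h ≡ q
      div-unique {q} (suc h) _ refl = m*n/n≡m q (suc h)

  -- The exchange step

  -- Lying between `B ∩ A` and `A ∪ B` and differing from `B` is what later forces `B′` to be closer
  -- to `A`.
  NewBase : ∀ {m} → Matroid m → (Fin m → Fin n) → Subset m → Subset m → Set
  NewBase M ℓ A B = ∃[ B′ ] IsBase M B′ × labelSum G ℓ B′ ≡ labelSum G ℓ B × B′ ≢ B × B ∩ A ⊆ B′ × B′ ⊆ A ∪ B

  -- Labels are constrained only on the symmetric difference of `A` and `B`. This lets the induction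
  -- pass to a subgroup although labels elsewhere may lie outside it.
  Exchangeable : Subgroup G → Set₁
  Exchangeable K = ∀ {m} (M : Matroid m) (ℓ : Fin m → Fin n) {A B} → IsBase M A → IsBase M B →
    (∀ {e} → e ∈ A ─ B → ℓ e ∈ Subgroup.carrier K) → (∀ {e} → e ∈ B ─ A → ℓ e ∈ Subgroup.carrier K) →
    ∣ Subgroup.carrier K ∣ ≤ ∣ A ─ B ∣ → NewBase M ℓ A B

  -- Replace `A` by a base `A′` that differs from `B` only inside one coset of `H`. Translating by
  -- `⊖ g` moves the labels on that difference into `H`, where exchangeability of the smaller group
  -- applies.
  exchange-in-coset : ∀ Hs → Exchangeable Hs → ∀ {m} (M : Matroid m) (ℓ : Fin m → Fin n) {A B} → IsBase M B →
    let H = Subgroup.carrier Hs in ∀ g {A₁ D} →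
    A₁ ⊆ (A ─ B) ∩ preimage G ℓ (coset G g H) → D ⊆ (B ─ A) ∩ preimage G ℓ (coset G g H) →
    Matroid.Indep M (A₁ ∪ (B ─ D)) → ∣ H ∣ ≤ ∣ A₁ ∣ → NewBase M ℓ A B
  exchange-in-coset Hs exch M ℓ {A} {B} B-base g {A₁} {D} A₁⊆ D⊆ ind H≤A₁ =
    -- Extending within `A₁ ∪ B` keeps `A′ ─ B` inside `A₁` and `B ─ A′` inside `D`; since this set
    -- contains `B`, the result is a base.
    from-extension (extend M (∪-lub (p⊆p∪q B) (q⊆p∪q A₁ B ∘ p─q⊆p B D)) ind)
    where
    open Matroid M
    H = Subgroup.carrier Hs
    E = preimage G ℓ (coset G g H)
    A₁⊆A─B : A₁ ⊆ A ─ B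
    A₁⊆A─B = p∩q⊆p (A ─ B) E ∘ A₁⊆
    D⊆B─A : D ⊆ B ─ A
    D⊆B─A = p∩q⊆p (B ─ A) E ∘ D⊆
    shift : ∀ {e} → e ∈ E → (⊖ g) ⊕ ℓ e ∈ H
    shift e∈ = coset-shift g H (∈-preimage⁻ ℓ (coset G g H) e∈)
    from-extension : (∃[ A′ ] A₁ ∪ (B ─ D) ⊆ A′ × A′ ⊆ A₁ ∪ B × Indep A′ × ∣ A′ ∣ ≡ rank M (A₁ ∪ B)) → NewBase M ℓ A B
    from-extension (A′ , ⊆A′ , A′⊆ , iA′ , ∣A′∣≡) = from-newBase (exch M (λ e → (⊖ g) ⊕ ℓ e) A′-base B-base
        (λ e∈ → shift (proj₂ (x∈p∩q⁻ (A ─ B) E (A₁⊆ (A′─B⊆A₁ e∈)))))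
        (λ e∈ → shift (proj₂ (x∈p∩q⁻ (B ─ A) E (D⊆ (B─A′⊆D e∈)))))
        (≤-trans H≤A₁ (p⊆q⇒∣p∣≤∣q∣ A₁⊆A′─B)))
      where
      A′-base : IsBase M A′
      A′-base = ∣base∣≤⇒base M B-base iA′ (subst (∣ B ∣ ≤_) (sym ∣A′∣≡) (indep⇒∣∣≤rank M (q⊆p∪q A₁ B) (proj₁ B-base)))
      B─D⊆A′ : B ─ D ⊆ A′
      B─D⊆A′ = ⊆A′ ∘ q⊆p∪q A₁ (B ─ D)
      A′─B⊆A₁ : A′ ─ B ⊆ A₁
      A′─B⊆A₁ x∈ with x∈p─q⁻ A′ B x∈
      ... | x∈A′ , x∉B = [ id , ⊥-elim ∘ x∉B ]′ (x∈p∪q⁻ A₁ B (A′⊆ x∈A′))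
      B─A′⊆D : B ─ A′ ⊆ D
      B─A′⊆D {x} x∈ with x∈p─q⁻ B A′ x∈
      ... | x∈B , x∉A′ = decidable-stable (x ∈? D) λ x∉D → x∉A′ (B─D⊆A′ (x∈p∧x∉q⇒x∈p─q x∈B x∉D))
      A₁⊆A′─B : A₁ ⊆ A′ ─ B
      A₁⊆A′─B x∈ = x∈p∧x∉q⇒x∈p─q (⊆A′ (p⊆p∪q (B ─ D) x∈)) (proj₂ (x∈p─q⁻ A B (A₁⊆A─B x∈)))
      -- `D` avoids `A`, so removing it from `B` leaves `B ∩ A` intact. A base new for `A′` and `B`
      -- is therefore also new for `A` and `B`.
      B∩A⊆B∩A′ : B ∩ A ⊆ B ∩ A′
      B∩A⊆B∩A′ x∈ with x∈p∩q⁻ B A x∈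
      ... | x∈B , x∈A = x∈p∩q⁺ (x∈B , B─D⊆A′ (x∈p∧x∉q⇒x∈p─q x∈B λ x∈D → proj₂ (x∈p─q⁻ B A (D⊆B─A x∈D)) x∈A))
      A′⊆A∪B : A′ ⊆ A ∪ B
      A′⊆A∪B = ∪-lub (p⊆p∪q B ∘ p─q⊆p A B ∘ A₁⊆A─B) (q⊆p∪q A B) ∘ A′⊆
      from-newBase : NewBase M (λ e → (⊖ g) ⊕ ℓ e) A′ B → NewBase M ℓ A B
      from-newBase (B′ , B′-base , label , B′≢B , B∩A′⊆B′ , B′⊆) =
        B′ , B′-base , labelSum-untranslate (⊖ g) ℓ B′ B (base-∣∣ M B′-base B-base) label , B′≢B ,
        B∩A′⊆B′ ∘ B∩A⊆B∩A′ , ∪-lub A′⊆A∪B (q⊆p∪q A B) ∘ B′⊆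

  module Step (K : Subgroup G) (SS : SchrijverSeymour G K)
    (IH : ∀ H → ∣ Subgroup.carrier H ∣ < ∣ Subgroup.carrier K ∣ → Exchangeable H)
    {m} (M : Matroid m) (ℓ : Fin m → Fin n) {A B : Subset m} (A-base : IsBase M A) (B-base : IsBase M B)
    (ℓA∈K : ∀ {e} → e ∈ A ─ B → ℓ e ∈ Subgroup.carrier K) (ℓB∈K : ∀ {e} → e ∈ B ─ A → ℓ e ∈ Subgroup.carrier K)
    (K≤A─B : ∣ Subgroup.carrier K ∣ ≤ ∣ A ─ B ∣) {b : Fin m} (b∈B─A : b ∈ B ─ A)
    where
    open Matroid M
    open Subgroup K

    -- Contracting `C` puts `B ∩ A` into every lifted base. Leaving `b` out of `S` ensures that no
    -- lifted base equals `B`, while all of `A` survives in `C ∪ S`.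
    C S : Subset m
    C = B ∩ A
    S = (A ─ B) ∪ ((B ─ A) - b)

    S⊆ : ∀ {x} → x ∈ S → x ∈ A ─ B ⊎ (x ∈ B ─ A × x ≢ b)
    S⊆ x∈ with x∈p∪q⁻ (A ─ B) ((B ─ A) - b) x∈
    ... | inj₁ x∈A─B = inj₁ x∈A─B
    ... | inj₂ x∈B─A = inj₂ (x∈p-y⁻ (B ─ A) b x∈B─A)

    C⊆A : C ⊆ A
    C⊆A = p∩q⊆q B A

    C⊆B : C ⊆ B
    C⊆B = p∩q⊆p B A

    S∥C : Disjoint S C
    S∥C x∈S x∈C with S⊆ x∈S
    ... | inj₁ x∈A─B       = proj₂ (x∈p─q⁻ A B x∈A─B) (C⊆B x∈C)
    ... | inj₂ (x∈B─A , _) = proj₂ (x∈p─q⁻ B A x∈B─A) (C⊆A x∈C)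

    C∪e-indep : ∀ {e} → e ∈ S → Indep (C ∪ ⁅ e ⁆)
    C∪e-indep {e} e∈S with S⊆ e∈S
    ... | inj₁ e∈A─B       = indep-⊆ (∪-lub C⊆A λ x∈ → subst (_∈ A) (sym (x∈⁅y⁆⇒x≡y e x∈)) (p─q⊆p A B e∈A─B)) (proj₁ A-base)
    ... | inj₂ (e∈B─A , _) = indep-⊆ (∪-lub C⊆B λ x∈ → subst (_∈ B) (sym (x∈⁅y⁆⇒x≡y e x∈)) (p─q⊆p B A e∈B─A)) (proj₁ B-base)

    A⊆C∪S : A ⊆ C ∪ S
    A⊆C∪S {x} x∈A with x ∈? B
    ... | yes x∈B = p⊆p∪q S (x∈p∩q⁺ (x∈B , x∈A))
    ... | no  x∉B = q⊆p∪q C S (p⊆p∪q ((B ─ A) - b) (x∈p∧x∉q⇒x∈p─q x∈A x∉B))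

    open Minor M S∥C (indep-⊆ C⊆A (proj₁ A-base)) C∪e-indep

    ℓ′ : Fin ∣ S ∣ → Fin n
    ℓ′ = ℓ ∘ embedElem S

    ℓ∈K : ∀ {e} → e ∈ S → ℓ e ∈ carrier
    ℓ∈K e∈S with S⊆ e∈S
    ... | inj₁ e∈A─B       = ℓA∈K e∈A─B
    ... | inj₂ (e∈B─A , _) = ℓB∈K e∈B─A

    target : Fin n
    target = labelSum G ℓ (B ─ A)

    LM : Subset n
    LM = labelImage G minor ℓ′

    -- Adding `C` to a base of the minor with label `ℓ(B ─ A)` restores the full label of `B`, and
    -- the lifted base misses `b`.
    newBase-from-minor : target ∈ LM → NewBase M ℓ A B
    newBase-from-minor t∈ with ∈-labelImage⁻ minor ℓ′ t∈
    ... | X , X-base , ℓ′X≡t = lift X , lift-base A-base C⊆A A⊆C∪S X-base , label , B′≢B , p⊆p∪q (embed S X) , B′⊆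
      where
      open ≡-Reasoning
      label : labelSum G ℓ (lift X) ≡ labelSum G ℓ B
      label = begin
        labelSum G ℓ (C ∪ embed S X)                   ≡⟨ labelSum-∪ ℓ C (embed S X) (λ x∈C x∈ → S∥C (embed⊆ S X x∈) x∈C) ⟩
        labelSum G ℓ C ⊕ labelSum G ℓ (embed S X)      ≡⟨ cong (labelSum G ℓ C ⊕_) (trans (labelSum-embed ℓ S X) ℓ′X≡t) ⟩
        labelSum G ℓ C ⊕ labelSum G ℓ (B ─ A)          ≡⟨ sym (labelSum-∪ ℓ C (B ─ A) (∩-─-disjoint B A B)) ⟩
        labelSum G ℓ (C ∪ (B ─ A))                     ≡⟨ cong (labelSum G ℓ) (p∩q∪p─q≡p B A) ⟩
        labelSum G ℓ B                                 ∎
      B′≢B : lift X ≢ B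
      B′≢B B′≡B with x∈p∪q⁻ C (embed S X) (subst (b ∈_) (sym B′≡B) (p─q⊆p B A b∈B─A))
      ... | inj₁ b∈C = proj₂ (x∈p─q⁻ B A b∈B─A) (C⊆A b∈C)
      ... | inj₂ b∈X with S⊆ (embed⊆ S X b∈X)
      ... | inj₁ b∈A─B     = proj₂ (x∈p─q⁻ A B b∈A─B) (p─q⊆p B A b∈B─A)
      ... | inj₂ (_ , b≢b) = b≢b refl
      B′⊆ : lift X ⊆ A ∪ B
      B′⊆ x∈ with x∈p∪q⁻ C (embed S X) x∈
      ... | inj₁ x∈C = p⊆p∪q B (C⊆A x∈C)
      ... | inj₂ x∈X with S⊆ (embed⊆ S X x∈X)
      ... | inj₁ x∈A─B       = p⊆p∪q B (p─q⊆p A B x∈A─B)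
      ... | inj₂ (x∈B─A , _) = q⊆p∪q A B (p─q⊆p B A x∈B─A)

    module InCosets (Hs : Subgroup G) (H⊆K : Subgroup.carrier Hs ⊆ Subgroup.carrier K) where
      open Subgroup Hs using () renaming (carrier to H)
      open Cosets K Hs H⊆K

      E : Fin n → Subset m
      E g = preimage G ℓ (coset G g H)

      E′ : Fin n → Subset ∣ S ∣
      E′ g = preimage G ℓ′ (coset G g H)

      -- The obstruction to exchanging within the coset of `g`: the elements of `S` labeled there
      -- have nullity below `∣ H ∣` in the minor.
      LargeRank : Fin n → Set
      LargeRank g = ∣ S ∩ E g ∣ ≤ rank minor (E′ g) + (∣ H ∣ ∸ 1)

      -- Apply `exchange-or-independent` to the elements of the coset in `A ─ B` and in
      -- `(B ─ A) - b`. Either `∣ H ∣` of the former can be swapped in, or the large independent `J`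
      -- restricts to a large independent set of the minor.
      newBase-or-largeRank : Exchangeable Hs → ∀ g → NewBase M ℓ A B ⊎ LargeRank g
      newBase-or-largeRank exch g = case exchange-or-independent M ∣ H ∣ B-base P∥B D⊆B C⊆B C∥D C∪P-indep of λ where
          (inj₁ (A₁ , A₁⊆P , ind , H≤A₁)) → inj₁ (exchange-in-coset Hs exch M ℓ B-base g A₁⊆P D⊆ ind H≤A₁)
          (inj₂ (J , C⊆J , J⊆ , iJ , bound)) → inj₂ (largeRank C⊆J J⊆ iJ bound)
        where
        P D : Subset m
        P = (A ─ B) ∩ E g
        D = ((B ─ A) - b) ∩ E g
        D⊆ : D ⊆ (B ─ A) ∩ E g
        D⊆ x∈ = let x∈₁ , x∈E = x∈p∩q⁻ ((B ─ A) - b) (E g) x∈ in x∈p∩q⁺ (p─q⊆p (B ─ A) ⁅ b ⁆ x∈₁ , x∈E)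
        P∥B : Disjoint P B
        P∥B x∈P = proj₂ (x∈p─q⁻ A B (p∩q⊆p (A ─ B) (E g) x∈P))
        D⊆B : D ⊆ B
        D⊆B = p─q⊆p B A ∘ p∩q⊆p (B ─ A) (E g) ∘ D⊆
        C∥D : Disjoint C D
        C∥D x∈C x∈D = proj₂ (x∈p─q⁻ B A (p∩q⊆p (B ─ A) (E g) (D⊆ x∈D))) (C⊆A x∈C)
        C∪P-indep : Indep (C ∪ P)
        C∪P-indep = indep-⊆ (∪-lub C⊆A (p─q⊆p A B ∘ p∩q⊆p (A ─ B) (E g))) (proj₁ A-base)
        P∪D⊆E : P ∪ D ⊆ E g
        P∪D⊆E = ∪-lub (p∩q⊆q (A ─ B) (E g)) (p∩q⊆q ((B ─ A) - b) (E g))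
        P∪D⊆S : P ∪ D ⊆ S
        P∪D⊆S = ∪-lub (p⊆p∪q ((B ─ A) - b) ∘ p∩q⊆p (A ─ B) (E g)) (q⊆p∪q (A ─ B) ((B ─ A) - b) ∘ p∩q⊆p ((B ─ A) - b) (E g))
        ∣S∩E∣≤ : ∣ S ∩ E g ∣ ≤ ∣ P ∣ + ∣ D ∣
        ∣S∩E∣≤ = begin
          ∣ S ∩ E g ∣               ≡⟨ cong ∣_∣ (∩-distribʳ-∪ (E g) (A ─ B) ((B ─ A) - b)) ⟩
          ∣ P ∪ D ∣                 ≤⟨ m≤m+n (∣ P ∪ D ∣) (∣ P ∩ D ∣) ⟩
          ∣ P ∪ D ∣ + ∣ P ∩ D ∣     ≡⟨ ∣∪∣+∣∩∣ P D ⟩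
          ∣ P ∣ + ∣ D ∣             ∎
          where open ≤-Reasoning
        largeRank : ∀ {J} → C ⊆ J → J ⊆ C ∪ (P ∪ D) → Indep J →
          ∣ C ∣ + (∣ P ∣ + ∣ D ∣) ≤ ∣ J ∣ + (∣ H ∣ ∸ 1) → LargeRank g
        largeRank {J} C⊆J J⊆ iJ bound = +-cancelˡ-≤ ∣ C ∣ _ _ (begin
          ∣ C ∣ + ∣ S ∩ E g ∣                          ≤⟨ +-monoʳ-≤ ∣ C ∣ ∣S∩E∣≤ ⟩
          ∣ C ∣ + (∣ P ∣ + ∣ D ∣)                      ≤⟨ bound ⟩
          ∣ J ∣ + (∣ H ∣ ∸ 1)                          ≡⟨ cong (_+ (∣ H ∣ ∸ 1)) (sym (∣C∣+∣restrict∣ C⊆J J⊆C∪S)) ⟩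
          ∣ C ∣ + ∣ X ∣ + (∣ H ∣ ∸ 1)                  ≡⟨ +-assoc (∣ C ∣) (∣ X ∣) (∣ H ∣ ∸ 1) ⟩
          ∣ C ∣ + (∣ X ∣ + (∣ H ∣ ∸ 1))                ≤⟨ +-monoʳ-≤ ∣ C ∣ (+-monoˡ-≤ (∣ H ∣ ∸ 1) ∣X∣≤) ⟩
          ∣ C ∣ + (rank minor (E′ g) + (∣ H ∣ ∸ 1))    ∎)
          where
          open ≤-Reasoning
          J⊆C∪S : J ⊆ C ∪ S
          J⊆C∪S = ∪-lub (p⊆p∪q S) (q⊆p∪q C S ∘ P∪D⊆S) ∘ J⊆
          X : Subset ∣ S ∣
          X = restrict S (J ─ C)
          X⊆E′ : X ⊆ E′ g
          X⊆E′ i∈ with x∈p─q⁻ J C (∈-restrict⁻ S i∈)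
          ... | i∈J , i∉C with x∈p∪q⁻ C (P ∪ D) (J⊆ i∈J)
          ... | inj₁ i∈C = ⊥-elim (i∉C i∈C)
          ... | inj₂ i∈P∪D = ∈-preimage⁺ ℓ′ (coset G g H) (∈-preimage⁻ ℓ (coset G g H) (P∪D⊆E i∈P∪D))
          ∣X∣≤ : ∣ X ∣ ≤ rank minor (E′ g)
          ∣X∣≤ = indep⇒∣∣≤rank minor X⊆E′ (restrict-indep C⊆J J⊆C∪S iJ)

      FewLabels : Set
      FewLabels = ∣ H ∣ * ((cosetRankSum G minor ℓ′ K H + 1 ∸ rankM minor) ⊓ (∣ carrier ∣ div ∣ H ∣)) < ∣ carrier ∣

      -- A double count of `S`, which has `2r - 1` elements. Summing `LargeRank` over the `R` cosets
      -- bounds this by the rank sum plus `R(h - 1)`; few labels keep the rank sum plus 1 below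
      -- `r + R`. Together `2r < r + Rh = r + ∣ K ∣`, against `∣ K ∣ ≤ r`.
      ¬all-largeRank : FewLabels → ¬ (∀ g → LargeRank g)
      ¬all-largeRank few large = <-irrefl refl (begin-strict
        r + r                                ≡⟨ sym ∣S∣+1 ⟩
        suc ∣ S ∣                            ≤⟨ s≤s ∣S∣≤ ⟩
        suc (Σr + R * (h ∸ 1))               ≡⟨ cong (_+ R * (h ∸ 1)) (+-comm 1 Σr) ⟩
        -- Truncated subtraction can only help: adding the rank back gives at least `Σr + 1`.
        (Σr + 1) + R * (h ∸ 1)               ≤⟨ +-monoˡ-≤ (R * (h ∸ 1)) (m≤n+m∸n (Σr + 1) (rankM minor)) ⟩
        (rankM minor + (Σr + 1 ∸ rankM minor)) + R * (h ∸ 1)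
                                             <⟨ +-monoˡ-< (R * (h ∸ 1)) (+-mono-≤-< rM≤r excess<R) ⟩
        (r + R) + R * (h ∸ 1)                ≡⟨ +-assoc r R (R * (h ∸ 1)) ⟩
        r + (R + R * (h ∸ 1))                ≡⟨ cong (r +_) (sym (*-suc R (h ∸ 1))) ⟩
        r + R * suc (h ∸ 1)                  ≡⟨ cong (λ k → r + R * k) (m+[n∸m]≡n (0<∣carrier∣ Hs)) ⟩
        r + R * h                            ≡⟨ cong (r +_) lagrange ⟩
        r + ∣ carrier ∣                      ≤⟨ +-monoʳ-≤ r K≤A─B ⟩
        r + r                                ∎)
        where
        open ≤-Reasoning
        r h R Σr : ℕ
        r  = ∣ A ─ B ∣
        h  = ∣ H ∣
        R  = length reps
        Σr = cosetRankSum G minor ℓ′ K H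
        ∣S∣+1 : suc ∣ S ∣ ≡ r + r
        ∣S∣+1 = trans (cong suc (disjoint-∣∪∣ (A ─ B) ((B ─ A) - b) λ x∈ x∈′ →
            proj₂ (x∈p─q⁻ A B x∈) (p─q⊆p B A (p─q⊆p (B ─ A) ⁅ b ⁆ x∈′))))
          (trans (sym (+-suc r _)) (cong (r +_) (trans (∣p-x∣ b∈B─A) (base-∣─∣ M B-base A-base))))
        ∣S∣≤ : ∣ S ∣ ≤ Σr + R * (h ∸ 1)
        ∣S∣≤ = subst (_≤ Σr + R * (h ∸ 1)) (sum-coset-parts ℓ S ℓ∈K)
          (sum-map-≤ (λ g → ∣ S ∩ E g ∣) (λ g → rank minor (E′ g)) (h ∸ 1) reps (λ {g} _ → large g))
        rM≤r : rankM minor ≤ r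
        rM≤r = ≤-trans (rankM-minor≤ A-base C⊆A A⊆C∪S) (≤-reflexive (+-cancelˡ-≡ ∣ C ∣ _ _
          (trans (p⊆q⇒∣p∣+∣q─p∣ C⊆A) (trans (sym (∣p∩q∣+∣p─q∣ A B)) (cong (λ Z → ∣ Z ∣ + r) (∩-comm A B))))))
        min<R : (Σr + 1 ∸ rankM minor) ⊓ R < R
        min<R = *-cancelˡ-< h _ _ (begin-strict
          h * ((Σr + 1 ∸ rankM minor) ⊓ R)                    ≡⟨ cong (λ k → h * ((Σr + 1 ∸ rankM minor) ⊓ k)) (sym index) ⟩
          h * ((Σr + 1 ∸ rankM minor) ⊓ (∣ carrier ∣ div h))  <⟨ few ⟩
          ∣ carrier ∣                                         ≡⟨ sym lagrange ⟩
          R * h                                               ≡⟨ *-comm R h ⟩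
          h * R                                               ∎)
        -- By Lagrange the second argument of the minimum is `R` itself, so a minimum below `R` must
        -- come from the first.
        excess<R : Σr + 1 ∸ rankM minor < R
        excess<R = ≰⇒> λ R≤ → <⇒≢ min<R (m≥n⇒m⊓n≡n R≤)

      newBase-from-coset : Exchangeable Hs → FewLabels → NewBase M ℓ A B
      -- `LargeRank` is decidable and `g` ranges over a finite set, so a failing coset can be found;
      -- exchange works there whatever `g` is.
      newBase-from-coset exch few = let g , ¬large = Fin.¬∀⟶∃¬ n LargeRank (λ g → _ ≤? _) (¬all-largeRank few) in
        [ id , ⊥-elim ∘ ¬large ]′ (newBase-or-largeRank exch g)

    H : Subset n
    H = stab G K LM

    Hs : Subgroup G
    Hs = stabSubgroup K LM

    H⊆K : H ⊆ carrier
    H⊆K h∈ = proj₁ (∈-stab⁻ K LM h∈)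

    module _ (t∉ : target ∉ LM) where

      target∈K : target ∈ carrier
      target∈K = labelSum-∈ K ℓ (B ─ A) ℓB∈K

      LM<K : ∣ LM ∣ < ∣ carrier ∣
      LM<K = p⊂q⇒∣p∣<∣q∣ (LM⊆K , target , target∈K , t∉)
        where
        LM⊆K : LM ⊆ carrier
        LM⊆K y∈ with ∈-labelImage⁻ minor ℓ′ y∈
        ... | X , _ , refl = labelSum-∈ K ℓ′ X λ {i} _ → ℓ∈K (embedElem∈ S i)

      -- Take `y` to be the label of the base `A ─ C` of the minor. The difference of `target` and
      -- `y` lies in `K`, but if it stabilized `LM` it would carry `y` to the missing `target`.
      H<K : ∣ H ∣ < ∣ carrier ∣
      H<K = p⊂q⇒∣p∣<∣q∣ (H⊆K , target ⊕ (⊖ y) , ⊕-closed target∈K (⊖-closed y∈K) , λ h∈H →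
          t∉ (subst (_∈ LM) (//-rightDividesˡ y target) (proj₁ (proj₂ (∈-stab⁻ K LM h∈H)) y y∈LM)))
        where
        y : Fin n
        y = labelSum G ℓ′ (restrict S (A ─ C))
        y∈LM : y ∈ LM
        y∈LM = ∈-labelImage⁺ minor ℓ′ (restrict-base A-base C⊆A A⊆C∪S)
        y∈K : y ∈ carrier
        y∈K = labelSum-∈ K ℓ′ (restrict S (A ─ C)) λ {i} _ → ℓ∈K (embedElem∈ S i)

    newBase : NewBase M ℓ A B
    newBase = case target ∈? LM of λ where
      (yes t∈) → newBase-from-minor t∈
      (no t∉)  → InCosets.newBase-from-coset Hs H⊆K (IH Hs (H<K t∉))
        -- With `H` the stabilizer of `LM`, the lower bound on `∣ LM ∣` is the left side of
        -- `FewLabels`, and `LM` misses `target`.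
        (≤-<-trans (SS ∣ S ∣ minor ℓ′ (λ i → ℓ∈K (embedElem∈ S i))) (LM<K t∉))

  -- Strong induction on the order of `K`: each step descends to the stabilizer of the labels of a
  -- minor, a proper subgroup whenever a descent is made.
  exchangeable : (∀ K → SchrijverSeymour G K) → ∀ K → Exchangeable K
  exchangeable SS K = go K (<-wellFounded _)
    where
    go : ∀ K → Acc _<_ ∣ Subgroup.carrier K ∣ → Exchangeable K
    go K (acc rs) M ℓ {A} {B} A-base B-base ℓA∈K ℓB∈K K≤A─B =
      Step.newBase K (SS K) (λ H H<K → go H (rs H<K)) M ℓ A-base B-base ℓA∈K ℓB∈K K≤A─B (proj₂ B─A-nonempty)
      where
      B─A-nonempty : Nonempty (B ─ A)
      B─A-nonempty = 0<∣p∣⇒Nonempty (B ─ A)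
        (≤-trans (0<∣carrier∣ K) (≤-trans K≤A─B (≤-reflexive (base-∣─∣ M A-base B-base))))

-- From exchangeability to closeness

theorem4 : (G : FinAbGroup) →
    (∀ (K : Subgroup G) → SchrijverSeymour G K) →
    KClose G (FinAbGroup.n G ∸ 1)
theorem4 G SS m M ℓ g (B₀ , B₀-base , ℓB₀≡g) A A-base = go B₀ B₀-base ℓB₀≡g (<-wellFounded _)
  where
  open FinAbGroup G
  -- The `g`-base is replaced repeatedly; `∣ A ─ B ∣` strictly decreases until it is at most
  -- `n ∸ 1`.
  go : ∀ B → IsBase M B → labelSum G ℓ B ≡ g → Acc _<_ ∣ A ─ B ∣ →
       ∃[ B ] (IsBase M B × labelSum G ℓ B ≡ g × ∣ A ─ B ∣ ≤ n ∸ 1)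
  go B B-base ℓB≡g (acc rs) = case ∣ A ─ B ∣ ≤? n ∸ 1 of λ where
    (yes close) → B , B-base , ℓB≡g , close
    (no far)    → case exchangeable G SS (wholeGroup G) M ℓ A-base B-base (λ _ → ∈⊤) (λ _ → ∈⊤)
                         -- Exceeding `n ∸ 1` means being at least `1 + (n ∸ 1)`, hence at least
                         -- `n`, the order of the whole group.
                         (subst (_≤ ∣ A ─ B ∣) (sym (∣⊤∣≡n n)) (≤-trans (m≤n+m∸n n 1) (≰⇒> far))) of λ where
      (B′ , B′-base , ℓB′≡ℓB , B′≢B , B∩A⊆B′ , B′⊆) →
        go B′ B′-base (trans ℓB′≡ℓB ℓB≡g) (rs (intermediate-base-closer M B-base B′-base B′≢B B∩A⊆B′ B′⊆))
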